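{- Let $(G,\sigma)$ be a finite connected signed graph satisfying $CD_{p}^{\sigma}(K,N)$ with $p\geq2$, $N>1$ and $K>0$. Then the first (smallest) nonzero eigenvalue $\lambda_p^\sigma$ of $\Delta_p^\sigma$ satisfies \[ \lambda_{p}^{\sigma}\geq\left(\frac{1}{\mathrm{vol}(G)}\right)^{\frac{p-2}{2}}\left(\frac{NK}{N-1}\right)^{\frac{p}{2}}, \] where $\mathrm{vol}(G)=\sum_{x\in V}d_x$.
   Context: $G=(V,E)$ is a finite simple connected graph with degrees $d_x$; $\sigma:E\to\{\pm1\}$, $\sigma_{xy}=\sigma(\{x,y\})$. For $p>1$: $\Delta_{p}^{\sigma}f(x)=\frac{1}{d_{x}}\sum_{y\sim x}|\sigma_{xy}f(y)-f(x)|^{p-2}(\sigma_{xy}f(y)-f(x))$ (with $|t|^{p-2}t=0$ at $t=0$); eigenvalue $\lambda$: $-\Delta_{p}^{\sigma}f=\lambda|f|^{p-2}f$ for some nonzero $f$. $\Gamma_p^\sigma(f,g)(x)=\frac{1}{2d_{x}}\sum_{y\sim x}|\sigma_{xy}f(y)-f(x)|^{p-2}(\sigma_{xy}f(y)-f(x))(\sigma_{xy}g(y)-g(x))$; $\mathscr{L}^\sigma_{p,f}\varphi(x)=\frac{1}{d_{x}}\sum_{y\sim x}|\sigma_{xy}f(y)-f(x)|^{p-2}(\varphi(y)-\varphi(x))$; $\Gamma_{p,2}^\sigma(f,f)(x)=\frac12\mathscr{L}_{p,f}^\sigma(\Gamma^\sigma_p(f,f))(x)-\Gamma_p^\sigma(f,\Delta_p^\sigma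 f)(x)$. $(G,\sigma)$ satisfies $CD_p^\sigma(K,N)$ if at every $x\in V$, $\Gamma_{p,2}^{\sigma}(f,f)(x)\geq\frac{1}{N}(\Delta_{p}^{\sigma}f(x))^{2}+K(\Gamma^{\sigma}_{p}(f,f)(x))^{\frac{2p-2}{p}}$ for every $f:V\to\mathbb{R}$ with $\sigma_{xy}f(y)-f(x)\neq0$ for every $y\sim x$ ($\frac1N=0$ if $N=\infty$). -}

module Defs where

open import Algebra.Bundles using (CommutativeRing)
open import Algebra.Core using (Op₁; Op₂)
import Algebra.Properties.Semiring.Exp as Exp
import Algebra.Properties.Semiring.Mult as Mult
import Algebra.Properties.Semiring.Sum as Sum
open import Algebra.Structures using (IsCommutativeRing)
open import Data.Bool.Base using (if_then_else_)
open import Data.Fin.Base using (Fin)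
open import Data.Nat.Base using (ℕ; suc)
open import Data.Product.Base using (_×_; ∃; ∃-syntax)
open import Data.Sign.Base using (Sign)
open import Data.Unit.Base using (⊤)
open import Level using (0ℓ)
open import Relation.Binary.Construct.Closure.ReflexiveTransitive using (Star)
import Relation.Binary.Construct.NonStrictToStrict as NonStrictToStrict
open import Relation.Binary.Core using (Rel)
open import Relation.Binary.Definitions
  using (Decidable; Symmetric; Irreflexive)
open import Relation.Binary.PropositionalEquality.Core using (_≡_; _≢_)
open import Relation.Binary.Structures using (IsDecTotalOrder)
open import Relation.Nullary.Decidable.Core using (does)
open import Relation.Unary using (Pred; _∈_; Satisfiable)

------------------------------------------------------------------------
-- The real numbers

-- A Dedekind-complete ordered field. Classically ℝ is the only one up to
-- isomorphism, so a statement quantified over this record is a statement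
-- about ℝ. The inverse and the supremum are total operations, specified
-- only away from 0 and only on nonempty bounded predicates respectively.
record CompleteOrderedField : Set₁ where
  infix  9 _⁻¹
  infix  8 -_
  infixl 7 _*_
  infixl 6 _+_
  infix  4 _≤_
  field
    ℝ     : Set
    _+_   : Op₂ ℝ
    _*_   : Op₂ ℝ
    -_    : Op₁ ℝ
    _⁻¹   : Op₁ ℝ
    0# 1# : ℝ
    _≤_   : Rel ℝ 0ℓ
    sup   : Pred ℝ 0ℓ → ℝ

  UpperBound : Pred ℝ 0ℓ → Pred ℝ 0ℓ
  UpperBound S b = ∀ {s} → s ∈ S → s ≤ b

  field
    isCommutativeRing : IsCommutativeRing _≡_ _+_ _*_ -_ 0# 1#
    0≢1               : 0# ≢ 1#
    *-inverseʳ        : ∀ x → x ≢ 0# → x * x ⁻¹ ≡ 1#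
    isDecTotalOrder   : IsDecTotalOrder _≡_ _≤_
    +-monoˡ-≤         : ∀ z {x y} → x ≤ y → x + z ≤ y + z
    *-nonNeg          : ∀ {x y} → 0# ≤ x → 0# ≤ y → 0# ≤ x * y
    sup-upper         : ∀ S → Satisfiable S → Satisfiable (UpperBound S) →
                        sup S ∈ UpperBound S
    sup-least         : ∀ S → Satisfiable S → ∀ {b} → b ∈ UpperBound S →
                        sup S ≤ b

  commutativeRing : CommutativeRing 0ℓ 0ℓ
  commutativeRing = record { isCommutativeRing = isCommutativeRing }

  open CommutativeRing commutativeRing public using (_-_; semiring)
  open IsDecTotalOrder isDecTotalOrder public using (_≟_; _≤?_)
  open NonStrictToStrict _≡_ _≤_ public using (_<_)
  open Exp semiring public using (_^_)
  open Mult semiring public using () renaming (_×_ to _·_)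
  open Sum semiring public using (sum)

  infixl 7 _/_
  _/_ : Op₂ ℝ
  x / y = x * y ⁻¹

  2# : ℝ
  2# = 1# + 1#

  ∣_∣ : Op₁ ℝ
  ∣ t ∣ = if does (0# ≤? t) then t else - t

  -- The nonnegative t with t ≤ b^q for some rational q ≤ x, for b ≥ 1.
  -- Here q = (i - j) / (k + 1), and both inequalities are cleared of
  -- denominators and of negative exponents.
  PowersBelow : ℝ → ℝ → Pred ℝ 0ℓ
  PowersBelow b x t = 0# ≤ t × (∃[ i ] ∃[ j ] ∃[ k ]
    (i · 1# ≤ suc k · 1# * x + j · 1#  ×  t ^ suc k * b ^ j ≤ b ^ i))

  -- Real powers: b^x = sup {b^q | q ∈ ℚ, q ≤ x} for b ≥ 1, and
  -- b^x = ((b⁻¹)^x)⁻¹ for 0 < b < 1. At b = 0 the value is 1 for x = 0 and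
  -- 0 otherwise; negative bases get the same junk value.
  infixr 8 _^ᴿ_
  _^ᴿ_ : ℝ → ℝ → ℝ
  b ^ᴿ x =
    if does (b ≤? 0#) then (if does (x ≟ 0#) then 1# else 0#)
    else if does (1# ≤? b) then sup (PowersBelow b x)
    else sup (PowersBelow (b ⁻¹) x) ⁻¹

------------------------------------------------------------------------
-- Signed graphs

-- A finite simple graph on Fin n with a sign on each edge; the values of σ
-- on non-adjacent pairs carry no meaning and are never used.
record SignedGraph (n : ℕ) : Set₁ where
  infix 4 _~_ _~?_
  field
    _~_      : Rel (Fin n) 0ℓ
    _~?_     : Decidable _~_
    ~-sym    : Symmetric _~_
    ~-irrefl : Irreflexive _≡_ _~_
    σ        : Fin n → Fin n → Sign
    σ-sym    : ∀ {x y} → x ~ y → σ x y ≡ σ y x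

  Connected : Set
  Connected = ∀ x y → Star _~_ x y

------------------------------------------------------------------------
-- The signed p-Laplacian and the curvature-dimension condition

module SignedLaplacian (R : CompleteOrderedField) {n : ℕ} (G : SignedGraph n)
  where
  open CompleteOrderedField R
  open SignedGraph G

  V : Set
  V = Fin n

  sign : V → V → ℝ
  sign x y with σ x y
  ... | Sign.+ = 1#
  ... | Sign.- = - 1#

  sumNbrs : V → (V → ℝ) → ℝ
  sumNbrs x g = sum (λ y → if does (x ~? y) then g y else 0#)

  deg : V → ℝ
  deg x = sumNbrs x (λ _ → 1#)

  vol : ℝ
  vol = sum deg

  -- The signed difference σ_{xy} f(y) - f(x).
  ∂ : (V → ℝ) → V → V → ℝ
  ∂ f x y = sign x y * f y - f x

  -- |t|^{p-2} t; whatever the value of |0|^{p-2}, this is 0 at t = 0.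
  φ : ℝ → ℝ → ℝ
  φ p t = ∣ t ∣ ^ᴿ (p - 2#) * t

  Δ : ℝ → (V → ℝ) → (V → ℝ)
  Δ p f x = 1# / deg x * sumNbrs x (λ y → φ p (∂ f x y))

  IsEigenvalue : ℝ → ℝ → Set
  IsEigenvalue p μ = ∃[ f ] (∃[ x ] f x ≢ 0#) ×
                            (∀ x → - Δ p f x ≡ μ * φ p (f x))

  IsFirstNonzeroEigenvalue : ℝ → ℝ → Set
  IsFirstNonzeroEigenvalue p μ =
    IsEigenvalue p μ × μ ≢ 0# × (∀ ν → IsEigenvalue p ν → ν ≢ 0# → μ ≤ ν)

  Γ : ℝ → (V → ℝ) → (V → ℝ) → (V → ℝ)
  Γ p f g x =
    1# / (2# * deg x) * sumNbrs x (λ y → φ p (∂ f x y) * ∂ g x y)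

  𝓛 : ℝ → (V → ℝ) → (V → ℝ) → (V → ℝ)
  𝓛 p f h x =
    1# / deg x * sumNbrs x (λ y → ∣ ∂ f x y ∣ ^ᴿ (p - 2#) * (h y - h x))

  Γ₂ : ℝ → (V → ℝ) → (V → ℝ)
  Γ₂ p f x = 1# / 2# * 𝓛 p f (Γ p f f) x - Γ p f (Δ p f) x

  data Dimension : Set where
    fin : ℝ → Dimension
    ∞   : Dimension

  1<ᴰ_ : Dimension → Set
  1<ᴰ fin N = 1# < N
  1<ᴰ ∞     = ⊤

  1/ᴰ_ : Dimension → ℝ
  1/ᴰ fin N = 1# / N
  1/ᴰ ∞     = 0#

  -- N K / (N - 1), with limiting value K at N = ∞.
  dimFactor : Dimension → ℝ → ℝ
  dimFactor (fin N) K = N * K / (N - 1#)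
  dimFactor ∞       K = K

  CD : ℝ → ℝ → Dimension → Set
  CD p K N = ∀ x (f : V → ℝ) → (∀ y → x ~ y → ∂ f x y ≢ 0#) →
    (1/ᴰ N) * Δ p f x ^ 2 + K * Γ p f f x ^ᴿ ((2# * p - 2#) / p) ≤ Γ₂ p f x

module Submission where

-- Integrate the curvature condition against the weights d_x. The operator 𝓛
-- is antisymmetric and drops out, and Green's formula turns ∫ Γ₂(f,f) into
-- ∫ (Δf)² and, for an eigenfunction f, ∫ Γ(f,f) into μA with A = ∫ |f|^p. With
-- r = (2p-2)/p, Jensen's inequality bounds ∫ Γ^r below by vol (μA / vol)^r,
-- and |f|^p ≤ A (as d_x ≥ 1 where f x ≠ 0) gives ∫ (Δf)² ≤ μ² A^r. Comparing
-- the two bounds determines μ^(2-r) = μ^(2/p).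
--
-- All laws of real powers come from a uniqueness principle: a positive
-- homomorphism from (ℝ , +) to (ℝ , *) which is bounded on bounded intervals
-- is determined by its value at 1.

import Algebra.Properties.CommutativeSemigroup as CommutativeSemigroupProperties
import Algebra.Properties.CommutativeSemiring.Exp as CommutativeExp
import Algebra.Properties.Ring as RingProperties
import Algebra.Properties.Semiring.Mult as SemiringMult
import Algebra.Properties.Semiring.Mult.TCOptimised as OptimisedMult
import Algebra.Properties.Semiring.Sum as SemiringSum
import Algebra.Solver.Ring as RingSolver
open import Algebra.Bundles using (CommutativeRing)
open import Algebra.Solver.Ring.AlmostCommutativeRing using (AlmostCommutativeRing; fromCommutativeRing; _-Raw-AlmostCommutative⟶_)
open import Data.Bool.Base using (Bool; true; false; if_then_else_)
open import Data.Empty using (⊥-elim)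
open import Data.Fin.Base using (Fin; zero; suc)
import Data.Fin.Properties as Finₚ
open import Data.Integer.Base as ℤ using (ℤ; -[1+_])
import Data.Integer.Properties as ℤₚ
open import Data.Maybe.Base using (Maybe; just; nothing)
open import Data.Nat.Base as ℕ using (ℕ; zero; suc)
import Data.Nat.Properties as ℕₚ
open import Data.Product.Base using (_×_; _,_; proj₁; proj₂; ∃-syntax)
open import Data.Sign.Base using (Sign)
open import Data.Sum.Base using (_⊎_; inj₁; inj₂; [_,_]′)
open import Function.Base using (_∘_; _$_)
open import Level using (0ℓ)
open import Relation.Binary.Bundles using (DecTotalOrder)
import Relation.Binary.Properties.DecTotalOrder as DecTotalOrderProperties
open import Relation.Binary.PropositionalEquality
import Relation.Binary.Reasoning.PartialOrder as PartialOrderReasoning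
open import Relation.Nullary using (¬_; yes; no; contradiction; does)
open import Relation.Nullary.Decidable using (decidable-stable; dec-false; dec-true; toSum)
open import Relation.Nullary.Negation using (Stable)
open import Relation.Unary using (Pred; Satisfiable; _∈_)

open import Defs

-- The curvature condition is given only for functions without vanishing signed differences at the
-- point, and an eigenfunction may have some. A small bump at the point removes them, and p ≥ 2
-- keeps every exponent nonnegative, so the inequality survives the limit in which the bump
-- disappears. Jensen's inequality is the tangent line of t^r at the mean, hence Bernoulli's
-- inequality for a real exponent r ≥ 1, reached through rational exponents.
--
-- The constant NK / (N - 1) is the solution κ of κ (1 - 1/N) = K: moving (1/N) ∫ (Δf)² to the other
-- side leaves κ ∫ Γ^r ≤ ∫ (Δf)². The powers of A then cancel, what remains is (1/vol)^((p-2)/p) κ ≤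
-- μ^(2/p), and the power p/2 gives the stated exponents.
--
-- Natural bounds for real numbers are available only up to double negation. Every use of them ends
-- in a stable goal, in most cases an inequality of the decidable order.

-- Arithmetic and order in a Dedekind-complete field.

module OrderedField (R : CompleteOrderedField) where
  open CompleteOrderedField R public
  open CommutativeRing commutativeRing public
    using (+-comm; +-assoc; *-comm; *-assoc; +-identityˡ; +-identityʳ; *-identityˡ; *-identityʳ
          ; distribˡ; distribʳ; zeroˡ; zeroʳ; -‿inverseʳ; ring; commutativeSemiring)
  open RingProperties ring public using (-‿involutive; -‿distribˡ-*; -‿distribʳ-*; -0#≈0#; -‿+-comm)
  open SemiringMult semiring public using (×-homo-+; ×1-homo-*)
  open CommutativeSemigroupProperties (CommutativeRing.*-commutativeSemigroup commutativeRing) public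
    using () renaming (interchange to *-interchange)
  open CommutativeSemigroupProperties (CommutativeRing.+-commutativeSemigroup commutativeRing) public
    using () renaming (interchange to +-interchange)
  private module Exp = CommutativeExp commutativeSemiring
  private module Opt = OptimisedMult semiring

  ^-homo-* : ∀ x m n → x ^ (m ℕ.+ n) ≡ x ^ m * x ^ n
  ^-homo-* = Exp.^-homo-*

  ^-assocʳ : ∀ x m n → (x ^ m) ^ n ≡ x ^ (m ℕ.* n)
  ^-assocʳ = Exp.^-assocʳ

  ^-distrib-* : ∀ x y n → (x * y) ^ n ≡ x ^ n * y ^ n
  ^-distrib-* = Exp.^-distrib-*

  -- The multiplication `Opt.×` is chosen because `1 Opt.× 1#` reduces to `1#`, which lets `1-homo`
  -- be `refl` and solver equations mention `1#` literally.
  ⟦_⟧ℤ : ℤ → ℝ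
  ⟦ ℤ.+ n ⟧ℤ      = n Opt.× 1#
  ⟦ -[1+ n ] ⟧ℤ = - (suc n Opt.× 1#)

  private
    neg-homo : ∀ z → ⟦ ℤ.- z ⟧ℤ ≡ - ⟦ z ⟧ℤ
    neg-homo (ℤ.+ zero)  = sym -0#≈0#
    neg-homo (ℤ.+ suc n) = refl
    neg-homo -[1+ n ]  = sym (-‿involutive _)

    pos-homo-+ : ∀ m n → (m ℕ.+ n) Opt.× 1# ≡ m Opt.× 1# + n Opt.× 1#
    pos-homo-+ = Opt.×-homo-+ 1#

    -- By hand, since the ring solver is built on the homomorphism being proved here.
    shift-sub : ∀ a b → a - b ≡ (1# + a) - (1# + b)
    shift-sub a b = begin
      a + - b                        ≡⟨ +-identityˡ _ ⟨
      0# + (a + - b)                 ≡⟨ cong (_+ (a + - b)) (-‿inverseʳ 1#) ⟨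
      (1# + - 1#) + (a + - b)        ≡⟨ +-assoc _ _ _ ⟩
      1# + (- 1# + (a + - b))        ≡⟨ cong (λ u → 1# + u)
          (trans (sym (+-assoc _ _ _)) (cong (_+ - b) (+-comm _ _))) ⟩
      1# + ((a + - 1#) + - b)        ≡⟨ cong (λ u → 1# + u) (+-assoc _ _ _) ⟩
      1# + (a + (- 1# + - b))        ≡⟨ +-assoc _ _ _ ⟨
      (1# + a) + (- 1# + - b)        ≡⟨ cong ((1# + a) +_) (-‿+-comm 1# b) ⟩
      (1# + a) + - (1# + b)          ∎
      where open ≡-Reasoning

    ⊖-homo : ∀ m n → ⟦ m ℤ.⊖ n ⟧ℤ ≡ m Opt.× 1# - n Opt.× 1#
    ⊖-homo zero    zero    = sym (-‿inverseʳ _)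
    ⊖-homo zero    (suc n) = sym (+-identityˡ _)
    ⊖-homo (suc m) zero    = sym (trans (cong (λ u → suc m Opt.× 1# + u) -0#≈0#) (+-identityʳ _))
    ⊖-homo (suc m) (suc n) = begin
      ⟦ suc m ℤ.⊖ suc n ⟧ℤ                  ≡⟨ cong ⟦_⟧ℤ (ℤₚ.[1+m]⊖[1+n]≡m⊖n m n) ⟩
      ⟦ m ℤ.⊖ n ⟧ℤ                          ≡⟨ ⊖-homo m n ⟩
      m Opt.× 1# - n Opt.× 1#               ≡⟨ shift-sub _ _ ⟩
      (1# + m Opt.× 1#) - (1# + n Opt.× 1#) ≡⟨ cong₂ _-_ (Opt.1+× m 1#) (Opt.1+× n 1#) ⟨
      suc m Opt.× 1# - suc n Opt.× 1#       ∎
      where open ≡-Reasoning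

    +-homo : ∀ y z → ⟦ y ℤ.+ z ⟧ℤ ≡ ⟦ y ⟧ℤ + ⟦ z ⟧ℤ
    +-homo (ℤ.+ m)    (ℤ.+ n)    = pos-homo-+ m n
    +-homo (ℤ.+ m)    -[1+ n ] = ⊖-homo m (suc n)
    +-homo -[1+ m ] (ℤ.+ n)    = trans (⊖-homo n (suc m)) (+-comm _ _)
    +-homo -[1+ m ] -[1+ n ] = begin
      - (suc (suc (m ℕ.+ n)) Opt.× 1#)     ≡⟨ cong (λ k → - (k Opt.× 1#)) (ℕₚ.+-suc (suc m) n) ⟨
      - ((suc m ℕ.+ suc n) Opt.× 1#)       ≡⟨ cong -_ (pos-homo-+ (suc m) (suc n)) ⟩
      - (suc m Opt.× 1# + suc n Opt.× 1#)  ≡⟨ -‿+-comm _ _ ⟨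
      - (suc m Opt.× 1#) + - (suc n Opt.× 1#) ∎
      where open ≡-Reasoning

    *-homo-pos : ∀ m z → ⟦ ℤ.+ m ℤ.* z ⟧ℤ ≡ ⟦ ℤ.+ m ⟧ℤ * ⟦ z ⟧ℤ
    *-homo-pos m (ℤ.+ n) = trans (cong ⟦_⟧ℤ (sym (ℤₚ.pos-* m n))) (Opt.×1-homo-* m n)
    *-homo-pos m -[1+ n ] = begin
      ⟦ ℤ.+ m ℤ.* -[1+ n ] ⟧ℤ        ≡⟨ cong ⟦_⟧ℤ (ℤₚ.neg-distribʳ-* (ℤ.+ m) (ℤ.+ suc n)) ⟨
      ⟦ ℤ.- (ℤ.+ m ℤ.* ℤ.+ suc n) ⟧ℤ   ≡⟨ neg-homo (ℤ.+ m ℤ.* ℤ.+ suc n) ⟩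
      - ⟦ ℤ.+ m ℤ.* ℤ.+ suc n ⟧ℤ       ≡⟨ cong -_ (*-homo-pos m (ℤ.+ suc n)) ⟩
      - (⟦ ℤ.+ m ⟧ℤ * ⟦ ℤ.+ suc n ⟧ℤ)  ≡⟨ -‿distribʳ-* _ _ ⟩
      ⟦ ℤ.+ m ⟧ℤ * ⟦ -[1+ n ] ⟧ℤ     ∎
      where open ≡-Reasoning

    *-homo : ∀ y z → ⟦ y ℤ.* z ⟧ℤ ≡ ⟦ y ⟧ℤ * ⟦ z ⟧ℤ
    *-homo (ℤ.+ m) z = *-homo-pos m z
    *-homo -[1+ m ] z = begin
      ⟦ -[1+ m ] ℤ.* z ⟧ℤ          ≡⟨ cong ⟦_⟧ℤ (ℤₚ.neg-distribˡ-* (ℤ.+ suc m) z) ⟨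
      ⟦ ℤ.- (ℤ.+ suc m ℤ.* z) ⟧ℤ     ≡⟨ neg-homo (ℤ.+ suc m ℤ.* z) ⟩
      - ⟦ ℤ.+ suc m ℤ.* z ⟧ℤ         ≡⟨ cong -_ (*-homo-pos (suc m) z) ⟩
      - (⟦ ℤ.+ suc m ⟧ℤ * ⟦ z ⟧ℤ)    ≡⟨ -‿distribˡ-* _ _ ⟩
      ⟦ -[1+ m ] ⟧ℤ * ⟦ z ⟧ℤ       ∎
      where open ≡-Reasoning

    almostRing : AlmostCommutativeRing 0ℓ 0ℓ
    almostRing = fromCommutativeRing commutativeRing

    ℤ⟶ℝ : ℤ.+-*-rawRing -Raw-AlmostCommutative⟶ almostRing
    ℤ⟶ℝ = record
      { ⟦_⟧ = ⟦_⟧ℤ ; +-homo = +-homo ; *-homo = *-homo ; -‿homo = neg-homo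
      ; 0-homo = refl ; 1-homo = refl }

    _≟ℤ_ : (y z : ℤ) → Maybe (⟦ y ⟧ℤ ≡ ⟦ z ⟧ℤ)
    y ≟ℤ z with y ℤₚ.≟ z
    ... | yes y≡z = just (cong ⟦_⟧ℤ y≡z)
    ... | no  _   = nothing

  -- Integer coefficients, because 0# ≟_ does not compute and the solver could
  -- not cancel x - x with coefficients in ℝ.
  module Solver = RingSolver ℤ.+-*-rawRing almostRing ℤ⟶ℝ _≟ℤ_
  open Solver public using (solve; con; _:=_; _:+_; _:*_; _:-_; :-_)

  :0 :1 : ∀ {n} → Solver.Polynomial n
  :0 = con (ℤ.+ 0)
  :1 = con (ℤ.+ 1)

  decTotalOrder : DecTotalOrder 0ℓ 0ℓ 0ℓ
  decTotalOrder = record { isDecTotalOrder = isDecTotalOrder }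

  open DecTotalOrder decTotalOrder public
    using () renaming (refl to ≤-refl; reflexive to ≤-reflexive; trans to ≤-trans
                      ; antisym to ≤-antisym; total to ≤-total; poset to ≤-poset)
  open DecTotalOrderProperties decTotalOrder public
    using (<-trans; <⇒≱; ≰⇒>; ≮⇒≥)
  module ≤-Reasoning = PartialOrderReasoning ≤-poset

  <⇒≤ : ∀ {x y} → x < y → x ≤ y
  <⇒≤ = proj₁

  -- The escape from double negation: `archimedean` and `floor` only give `¬ ¬ ∃`, which suffices
  -- wherever the goal is an inequality.
  ≤-stable : ∀ {x y} → Stable (x ≤ y)
  ≤-stable {x} {y} = decidable-stable (x ≤? y)

  ≤-<-trans : ∀ {x y z} → x ≤ y → y < z → x < z
  ≤-<-trans x≤y y<z = ≰⇒> λ z≤x → <⇒≱ y<z (≤-trans z≤x x≤y)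

  <-≤-trans : ∀ {x y z} → x < y → y ≤ z → x < z
  <-≤-trans x<y y≤z = ≰⇒> λ z≤x → <⇒≱ x<y (≤-trans y≤z z≤x)

  ≤-<-dec : ∀ x y → x ≤ y ⊎ y < x
  ≤-<-dec x y with x ≤? y
  ... | yes x≤y = inj₁ x≤y
  ... | no  x≰y = inj₂ (≰⇒> x≰y)

  +-mono-≤ : ∀ {w x y z} → w ≤ x → y ≤ z → w + y ≤ x + z
  +-mono-≤ {w} {x} {y} {z} w≤x y≤z = ≤-trans (+-monoˡ-≤ y w≤x)
    (subst₂ _≤_ (+-comm y x) (+-comm z x) (+-monoˡ-≤ x y≤z))

  +-cancelʳ-≤ : ∀ z {x y} → x + z ≤ y + z → x ≤ y
  +-cancelʳ-≤ z {x} {y} le = subst₂ _≤_ (eq x) (eq y) (+-monoˡ-≤ (- z) le)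
    where
    eq : ∀ a → a + z + - z ≡ a
    eq a = solve 2 (λ a z → a :+ z :+ :- z := a) refl a z

  ≤⇒0≤- : ∀ {x y} → x ≤ y → 0# ≤ y - x
  ≤⇒0≤- {x} {y} x≤y = subst (_≤ y - x) (-‿inverseʳ x) (+-monoˡ-≤ (- x) x≤y)

  ≤-by : ∀ {x y d} → 0# ≤ d → y ≡ x + d → x ≤ y
  ≤-by {x} {y} {d} 0≤d eq = subst₂ _≤_ (+-identityˡ x) (trans (+-comm d x) (sym eq)) (+-monoˡ-≤ x 0≤d)

  0≤-⇒≤ : ∀ {x y} → 0# ≤ y - x → x ≤ y
  0≤-⇒≤ {x} {y} p = ≤-by p (solve 2 (λ x y → y := x :+ (y :- x)) refl x y)

  0≤-+ : ∀ {x y} → 0# ≤ x → 0# ≤ y → 0# ≤ x + y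
  0≤-+ {x} {y} p q = subst (_≤ x + y) (+-identityˡ 0#) (+-mono-≤ p q)

  neg-mono-≤ : ∀ {x y} → x ≤ y → - y ≤ - x
  neg-mono-≤ {x} {y} x≤y = ≤-by (≤⇒0≤- x≤y) (solve 2 (λ x y → :- x := :- y :+ (y :- x)) refl x y)

  neg≤0 : ∀ {x} → x ≤ 0# → 0# ≤ - x
  neg≤0 {x} x≤0 = subst (_≤ - x) -0#≈0# (neg-mono-≤ x≤0)

  *-monoʳ-≤ : ∀ {z x y} → 0# ≤ z → x ≤ y → z * x ≤ z * y
  *-monoʳ-≤ {z} {x} {y} 0≤z x≤y = ≤-by (*-nonNeg 0≤z (≤⇒0≤- x≤y))
    (solve 3 (λ x y z → z :* y := z :* x :+ z :* (y :- x)) refl x y z)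

  *-monoˡ-≤ : ∀ {z x y} → 0# ≤ z → x ≤ y → x * z ≤ y * z
  *-monoˡ-≤ {z} {x} {y} 0≤z x≤y = subst₂ _≤_ (*-comm z x) (*-comm z y) (*-monoʳ-≤ 0≤z x≤y)

  *-mono-≤ : ∀ {w x y z} → 0# ≤ w → 0# ≤ y → w ≤ x → y ≤ z → w * y ≤ x * z
  *-mono-≤ 0≤w 0≤y w≤x y≤z = ≤-trans (*-monoˡ-≤ 0≤y w≤x) (*-monoʳ-≤ (≤-trans 0≤w w≤x) y≤z)

  sq-nonNeg : ∀ x → 0# ≤ x * x
  sq-nonNeg x with ≤-total 0# x
  ... | inj₁ 0≤x = *-nonNeg 0≤x 0≤x
  ... | inj₂ x≤0 = subst (0# ≤_) (solve 1 (λ x → (:- x) :* (:- x) := x :* x) refl x) (*-nonNeg 0≤-x 0≤-x)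
    where
    0≤-x : 0# ≤ - x
    0≤-x = subst (_≤ - x) -0#≈0# (neg-mono-≤ x≤0)

  0≤1 : 0# ≤ 1#
  0≤1 = subst (0# ≤_) (*-identityˡ 1#) (sq-nonNeg 1#)

  0<1 : 0# < 1#
  0<1 = 0≤1 , 0≢1

  <⇒≢ : ∀ {x y} → x < y → y ≢ x
  <⇒≢ = λ x<y y≡x → proj₂ x<y (sym y≡x)

  x≤x+1 : ∀ x → x ≤ x + 1#
  x≤x+1 x = ≤-by 0≤1 refl

  0<-+ˡ : ∀ {x y} → 0# < x → 0# ≤ y → 0# < x + y
  0<-+ˡ {x} {y} 0<x 0≤y = <-≤-trans 0<x (≤-by 0≤y refl)

  0<-+ʳ : ∀ {x y} → 0# ≤ x → 0# < y → 0# < x + y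
  0<-+ʳ {x} {y} 0≤x 0<y = <-≤-trans 0<y (≤-by 0≤x (+-comm x y))

  0<2 : 0# < 2#
  0<2 = 0<-+ˡ 0<1 0≤1

  *-zero-cancel : ∀ {x y} → x ≢ 0# → x * y ≡ 0# → y ≡ 0#
  *-zero-cancel {x} {y} x≢0 xy≡0 = begin
    y                ≡⟨ *-identityˡ y ⟨
    1# * y           ≡⟨ cong (_* y) (*-inverseʳ x x≢0) ⟨
    x * x ⁻¹ * y     ≡⟨ solve 3 (λ x z y → x :* z :* y := z :* (x :* y)) refl x (x ⁻¹) y ⟩
    x ⁻¹ * (x * y)   ≡⟨ cong (x ⁻¹ *_) xy≡0 ⟩
    x ⁻¹ * 0#        ≡⟨ zeroʳ _ ⟩
    0#               ∎
    where open ≡-Reasoning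

  0<-* : ∀ {x y} → 0# < x → 0# < y → 0# < x * y
  0<-* 0<x 0<y = *-nonNeg (proj₁ 0<x) (proj₁ 0<y) ,
    λ 0≡xy → <⇒≢ 0<y (*-zero-cancel (<⇒≢ 0<x) (sym 0≡xy))

  *-cancelˡ-≤ : ∀ {z x y} → 0# < z → z * x ≤ z * y → x ≤ y
  *-cancelˡ-≤ {z} {x} {y} 0<z le with ≤-<-dec x y
  ... | inj₁ x≤y = x≤y
  ... | inj₂ y<x = contradiction (≤-antisym le (*-monoʳ-≤ (<⇒≤ 0<z) (<⇒≤ y<x)))
    λ eq → proj₂ y<x (sym (x-y≡0 (*-zero-cancel (<⇒≢ 0<z) (trans
      (solve 3 (λ x y z → z :* (x :- y) := z :* x :- z :* y) refl x y z)
      (trans (cong (_- z * y) eq) (-‿inverseʳ _))))))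
    where
    x-y≡0 : x - y ≡ 0# → x ≡ y
    x-y≡0 e = trans (solve 2 (λ x y → x := (x :- y) :+ y) refl x y) (trans (cong (_+ y) e) (+-identityˡ y))

  *-cancelʳ-≤ : ∀ {z x y} → 0# < z → x * z ≤ y * z → x ≤ y
  *-cancelʳ-≤ {z} {x} {y} 0<z le = *-cancelˡ-≤ 0<z (subst₂ _≤_ (*-comm x z) (*-comm y z) le)

  *-cancelˡ-≡ : ∀ {z x y} → 0# < z → z * x ≡ z * y → x ≡ y
  *-cancelˡ-≡ 0<z eq = ≤-antisym (*-cancelˡ-≤ 0<z (≤-reflexive eq)) (*-cancelˡ-≤ 0<z (≤-reflexive (sym eq)))

  inv-pos : ∀ {x} → 0# < x → 0# < x ⁻¹
  inv-pos {x} 0<x = ≰⇒> λ x⁻¹≤0 → <⇒≱ 0<1 (subst₂ _≤_ (*-inverseʳ x (<⇒≢ 0<x)) (zeroʳ x)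
    (*-monoʳ-≤ (<⇒≤ 0<x) x⁻¹≤0))

  inverse : ∀ {x} → 0# < x → x * x ⁻¹ ≡ 1#
  inverse {x} 0<x = *-inverseʳ x (<⇒≢ 0<x)

  inverseˡ : ∀ {x} → 0# < x → x ⁻¹ * x ≡ 1#
  inverseˡ {x} 0<x = trans (*-comm _ x) (inverse 0<x)

  -- For field identities: a is some x * x ⁻¹, and x ≡ C a holds in every ring.
  by-unit : ∀ {a x y} → a ≡ 1# → (C : ℝ → ℝ) → x ≡ C a → C 1# ≡ y → x ≡ y
  by-unit a≡1 C p q = trans p (trans (cong C a≡1) q)

  inv-unique : ∀ {x y} → 0# < x → x * y ≡ 1# → y ≡ x ⁻¹
  inv-unique 0<x xy≡1 = *-cancelˡ-≡ 0<x (trans xy≡1 (sym (inverse 0<x)))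

  inv-involutive : ∀ {x} → 0# < x → (x ⁻¹) ⁻¹ ≡ x
  inv-involutive 0<x = sym (inv-unique (inv-pos 0<x) (inverseˡ 0<x))

  /-cancel : ∀ {x y} → 0# < y → x / y * y ≡ x
  /-cancel {x} {y} 0<y = by-unit (inverseˡ 0<y) (x *_) (*-assoc _ _ _) (*-identityʳ x)

  /-pos : ∀ {x y} → 0# < x → 0# < y → 0# < x / y
  /-pos 0<x 0<y = 0<-* 0<x (inv-pos 0<y)

  /-nonNeg : ∀ {x y} → 0# ≤ x → 0# < y → 0# ≤ x / y
  /-nonNeg 0≤x 0<y = *-nonNeg 0≤x (<⇒≤ (inv-pos 0<y))

  ≤-/ : ∀ {x y z} → 0# < z → x * z ≤ y → x ≤ y / z
  ≤-/ 0<z le = *-cancelʳ-≤ 0<z (≤-trans le (≤-reflexive (sym (/-cancel 0<z))))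

  one≤inv : ∀ {x} → 0# < x → x ≤ 1# → 1# ≤ x ⁻¹
  one≤inv {x} 0<x x≤1 = *-cancelˡ-≤ 0<x
    (subst₂ _≤_ (sym (*-identityʳ x)) (sym (inverse 0<x)) x≤1)

  -- Natural numbers, the Archimedean property and natural powers.

  ι : ℕ → ℝ
  ι n = n · 1#

  ι-+ : ∀ m n → ι (m ℕ.+ n) ≡ ι m + ι n
  ι-+ = ×-homo-+ 1#

  ι-* : ∀ m n → ι (m ℕ.* n) ≡ ι m * ι n
  ι-* = ×1-homo-*

  ι-nonNeg : ∀ n → 0# ≤ ι n
  ι-nonNeg zero    = ≤-refl
  ι-nonNeg (suc n) = 0≤-+ 0≤1 (ι-nonNeg n)

  ι-pos : ∀ n → 0# < ι (suc n)
  ι-pos n = 0<-+ˡ 0<1 (ι-nonNeg n)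

  ι-mono : ∀ {m n} → m ℕ.≤ n → ι m ≤ ι n
  ι-mono {m} {n} m≤n = ≤-by (ι-nonNeg (n ℕ.∸ m)) (trans (cong ι (sym (ℕₚ.m+[n∸m]≡n m≤n))) (ι-+ m _))

  ι-cancel-< : ∀ {m n} → ι m < ι n → m ℕ.< n
  ι-cancel-< lt = ℕₚ.≰⇒> λ n≤m → <⇒≱ lt (ι-mono n≤m)

  ι-cancel : ∀ {m n} → ι m ≤ ι n → m ℕ.≤ n
  ι-cancel {m} {n} le = ℕₚ.≮⇒≥ λ n<m → <⇒≱ (<-≤-trans (ι-suc-< n) (ι-mono n<m)) le
    where
    ι-suc-< : ∀ n → ι n < ι (suc n)
    ι-suc-< n = ≰⇒> λ le → <⇒≱ 0<1 (+-cancelʳ-≤ (ι n) (subst (1# + ι n ≤_) (sym (+-identityˡ _)) le))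

  -- The order is decidable, but the supremum only yields the natural
  -- number of the Archimedean property up to double negation.
  archimedean : ∀ x → ¬ ¬ (∃[ n ] x ≤ ι n)
  archimedean x ¬∃ = <⇒≱ 0<1 (+-cancelʳ-≤ s (subst (1# + s ≤_) (sym (+-identityˡ s)) 1+s≤s))
    where
    Naturals : Pred ℝ 0ℓ
    Naturals t = ∃[ n ] t ≡ ι n
    inhabited : Satisfiable Naturals
    inhabited = 0# , 0 , refl
    bounded : UpperBound Naturals x
    bounded (n , refl) = <⇒≤ (≰⇒> λ x≤ → ¬∃ (n , x≤))
    s : ℝ
    s = sup Naturals
    -- The naturals are closed under successor, so lowering the supremum by 1 still bounds them all.
    s-1-bound : UpperBound Naturals (s - 1#)
    s-1-bound (n , refl) = +-cancelʳ-≤ 1# (subst₂ _≤_ (+-comm 1# (ι n))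
      (solve 1 (λ s → s := s :- :1 :+ :1) refl s)
      (sup-upper Naturals inhabited (x , bounded) (suc n , refl)))
    1+s≤s : 1# + s ≤ s
    1+s≤s = subst (1# + s ≤_) (solve 1 (λ s → :1 :+ (s :- :1) := s) refl s)
      (+-mono-≤ (≤-refl {1#}) (sup-least Naturals inhabited s-1-bound))

  ^-nonNeg : ∀ {x} n → 0# ≤ x → 0# ≤ x ^ n
  ^-nonNeg zero    0≤x = 0≤1
  ^-nonNeg (suc n) 0≤x = *-nonNeg 0≤x (^-nonNeg n 0≤x)

  ^-pos : ∀ {x} n → 0# < x → 0# < x ^ n
  ^-pos zero    0<x = 0<1
  ^-pos (suc n) 0<x = 0<-* 0<x (^-pos n 0<x)

  1≤^ : ∀ {x} n → 1# ≤ x → 1# ≤ x ^ n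
  1≤^ zero 1≤x = ≤-refl
  1≤^ {x} (suc n) 1≤x = subst (_≤ x * x ^ n) (*-identityˡ 1#) (*-mono-≤ 0≤1 0≤1 1≤x (1≤^ n 1≤x))

  ^-mono-≤ : ∀ {x y} n → 0# ≤ x → x ≤ y → x ^ n ≤ y ^ n
  ^-mono-≤ zero    0≤x x≤y = ≤-refl
  ^-mono-≤ (suc n) 0≤x x≤y = *-mono-≤ 0≤x (^-nonNeg n 0≤x) x≤y (^-mono-≤ n 0≤x x≤y)

  ^-mono-exp : ∀ {x m n} → 1# ≤ x → m ℕ.≤ n → x ^ m ≤ x ^ n
  ^-mono-exp {x} {m} {n} 1≤x m≤n = subst₂ _≤_ (*-identityʳ _)
    (trans (sym (^-homo-* x m (n ℕ.∸ m))) (cong (x ^_) (ℕₚ.m+[n∸m]≡n m≤n)))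
    (*-monoʳ-≤ (^-nonNeg m (≤-trans 0≤1 1≤x)) (1≤^ (n ℕ.∸ m) 1≤x))

  1^n≡1 : ∀ n → 1# ^ n ≡ 1#
  1^n≡1 zero    = refl
  1^n≡1 (suc n) = trans (*-identityˡ _) (1^n≡1 n)

  ^-mono-< : ∀ {x y} n → 0# ≤ x → x < y → x ^ suc n < y ^ suc n
  ^-mono-< {x} {y} n 0≤x x<y = ≤-<-trans (*-monoʳ-≤ 0≤x (^-mono-≤ n 0≤x (<⇒≤ x<y)))
    (≰⇒> λ le → <⇒≱ x<y (*-cancelʳ-≤ (^-pos n (≤-<-trans 0≤x x<y)) le))

  ^-cancel-≤ : ∀ {x y} n → 0# ≤ y → x ^ suc n ≤ y ^ suc n → x ≤ y
  ^-cancel-≤ n 0≤y le = ≮⇒≥ λ y<x → <⇒≱ (^-mono-< n 0≤y y<x) le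

  bernoulli : ∀ {u} n → 0# ≤ u → 1# + ι n * u ≤ (1# + u) ^ n
  bernoulli {u} zero 0≤u = ≤-reflexive (solve 1 (λ u → :1 :+ :0 :* u := :1) refl u)
  bernoulli {u} (suc n) 0≤u = ≤-trans
    (≤-by (*-nonNeg (ι-nonNeg n) (sq-nonNeg u))
      (solve 2 (λ u m → (:1 :+ u) :* (:1 :+ m :* u) :=
        :1 :+ (:1 :+ m) :* u :+ m :* (u :* u)) refl u (ι n)))
    (*-monoʳ-≤ (0≤-+ 0≤1 0≤u) (bernoulli n 0≤u))

  -- Otherwise `M / u` would bound all natural numbers. This turns estimates with an error of order
  -- `1 / n` into exact ones.
  bounded-multiples : ∀ {u M} → (∀ n → ι n * u ≤ M) → u ≤ 0#
  bounded-multiples {u} {M} bound with ≤-<-dec u 0#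
  ... | inj₁ u≤0 = u≤0
  -- The summand `1#` supplies strictness: `bound` only gives `ι n ≤ M / u`.
  ... | inj₂ 0<u = ⊥-elim $ archimedean (M / u + 1#) λ (n , le) →
    <⇒≱ 0<1 (+-cancelʳ-≤ (M / u) (subst₂ _≤_ (+-comm _ _) (sym (+-identityˡ _))
        (≤-trans le (≤-/ 0<u (bound n)))))

  -- By Bernoulli a base above 1 has unbounded powers. Hence a constant that persists in all powers
  -- of an inequality can be discarded.
  bounded-powers : ∀ {c M} → (∀ n → c ^ n ≤ M) → c ≤ 1#
  bounded-powers {c} {M} bound with ≤-<-dec c 1#
  ... | inj₁ c≤1 = c≤1
  ... | inj₂ 1<c = contradiction (bounded-multiples {c - 1#} {M} λ n → ≤-trans (≤-trans
      (≤-by 0≤1 (+-comm 1# _)) (bernoulli n (≤⇒0≤- (<⇒≤ 1<c))))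
      (subst (λ z → z ^ n ≤ M) (solve 1 (λ c → c := :1 :+ (c :- :1)) refl c) (bound n)))
    λ le → <⇒≱ 1<c (0≤-⇒≤ (subst (0# ≤_) (solve 1 (λ c → :- (c :- :1) := :1 :- c) refl c)
      (subst (_≤ - (c - 1#)) -0#≈0# (neg-mono-≤ le))))

  -- Just above `u` the power grows at most linearly, with an explicit constant. The point `w`
  -- strictly above `u` will contradict a supremum equal to `u`.
  ^-right-continuous : ∀ {u v} n → 0# ≤ u → u ^ n < v → ∃[ w ] (u < w × w ^ n ≤ v)
  ^-right-continuous {u} {v} n 0≤u uⁿ<v = u + ε , u<u+ε , ≤-trans (proj₂ (proj₂ (modulus n)) 0≤ε ε≤1)
    (≤-trans (+-mono-≤ ≤-refl εC≤) (≤-reflexive (solve 2 (λ a v → a :+ (v :- a) := v) refl (u ^ n) v)))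
    where
    modulus : ∀ n → ∃[ C ] (0# ≤ C × (∀ {ε} → 0# ≤ ε → ε ≤ 1# → (u + ε) ^ n ≤ u ^ n + ε * C))
    modulus zero = 0# , ≤-refl , λ {ε} _ _ →
      ≤-reflexive (solve 1 (λ e → :1 := :1 :+ e :* :0) refl ε)
    modulus (suc n) with modulus n
    -- The new constant is the coefficient of `ε` in `(u + ε) * (u ^ n + ε * C)` once `ε * ε` is
    -- estimated by `ε`.
    ... | C , 0≤C , bound = C * (u + 1#) + u ^ n
      , 0≤-+ (*-nonNeg 0≤C (0≤-+ 0≤u 0≤1)) (^-nonNeg n 0≤u)
      , λ {ε} 0≤ε ε≤1 → ≤-trans (*-monoʳ-≤ (0≤-+ 0≤u 0≤ε) (bound 0≤ε ε≤1))
        (≤-by (*-nonNeg (*-nonNeg 0≤ε 0≤C) (≤⇒0≤- ε≤1))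
          (solve 4 (λ u e c a → u :* a :+ e :* (c :* (u :+ :1) :+ a) :=
            (u :+ e) :* (a :+ e :* c) :+ e :* c :* (:1 :- e)) refl u ε C (u ^ n)))
    C gap : ℝ
    C = proj₁ (modulus n)
    gap = v - u ^ n
    0<gap : 0# < gap
    0<gap = ≰⇒> λ le → <⇒≱ uⁿ<v (≤-by (subst (_≤ - gap) -0#≈0# (neg-mono-≤ le))
      (solve 2 (λ a v → a := v :+ :- (v :- a)) refl (u ^ n) v))
    0<1+C : 0# < C + 1#
    0<1+C = 0<-+ʳ (proj₁ (proj₂ (modulus n))) 0<1
    -- The minimum of 1 and `gap / (C + 1#)`; the added `1#` is there because `C` may be 0.
    small : ∃[ ε ] (0# < ε × ε ≤ 1# × ε ≤ gap / (C + 1#))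
    small with ≤-total 1# (gap / (C + 1#))
    ... | inj₁ le = 1# , 0<1 , ≤-refl , le
    ... | inj₂ ge = gap / (C + 1#) , /-pos 0<gap 0<1+C , ge , ≤-refl
    ε : ℝ
    ε = proj₁ small
    0<ε = proj₁ (proj₂ small)
    0≤ε = <⇒≤ 0<ε
    ε≤1 = proj₁ (proj₂ (proj₂ small))
    εC≤ : ε * C ≤ gap
    εC≤ = ≤-trans (*-monoʳ-≤ 0≤ε (x≤x+1 C))
      (subst (ε * (C + 1#) ≤_) (/-cancel 0<1+C) (*-monoˡ-≤ (<⇒≤ 0<1+C) (proj₂ (proj₂ (proj₂ small)))))
    u<u+ε : u < u + ε
    u<u+ε = ≰⇒> λ le → <⇒≱ 0<ε (+-cancelʳ-≤ u (subst₂ _≤_ (+-comm u ε) (sym (+-identityˡ u)) le))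

-- Real powers of a base at least 1 as suprema.

module RealPowers (R : CompleteOrderedField) where
  open OrderedField R

  ι-1 : ι 1 ≡ 1#
  ι-1 = +-identityʳ 1#

  ι-shift : ∀ n y → ι (suc n) + y ≡ ι n + (y + 1#)
  ι-shift n y = solve 2 (λ a y → (:1 :+ a) :+ y := a :+ (y :+ :1)) refl (ι n) y

  -- `archimedean` encloses `x` between `- ι m` and `ι n`, and unit shifts lead from there to the
  -- unit interval. Stability of `Q` absorbs the double negation, so no integer part has to be
  -- computed.
  translation-induction : {Q : ℝ → Set} → (∀ x → Stable (Q x)) →
    (∀ s → 0# ≤ s → s ≤ 1# → Q s) → (∀ x → Q x → Q (x + 1#)) → (∀ x → Q (x + 1#) → Q x) →
    ∀ x → Q x
  translation-induction {Q} stable unit up down x = stable x λ ¬Qx →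
    archimedean (- x) λ (m , -x≤m) → archimedean x λ (n , x≤n) →
      ¬Qx (below m {n} x (subst (0# ≤_) (solve 2 (λ a x → a :- :- x := a :+ x) refl (ι m) x)
          (≤⇒0≤- -x≤m)) x≤n)
    where
    above : ∀ n y → 0# ≤ y → y ≤ ι n → Q y
    above zero    y 0≤y y≤0 = unit y 0≤y (≤-trans y≤0 0≤1)
    above (suc n) y 0≤y y≤n with ≤-total y 1#
    ... | inj₁ y≤1 = unit y 0≤y y≤1
    ... | inj₂ 1≤y = subst Q (solve 1 (λ y → y :- :1 :+ :1 := y) refl y)
      (up (y - 1#) (above n (y - 1#) (≤⇒0≤- 1≤y)
        (+-cancelʳ-≤ 1# (subst₂ _≤_ (solve 1 (λ y → y := y :- :1 :+ :1) refl y) (+-comm _ _) y≤n))))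
    below : ∀ m {n} y → 0# ≤ ι m + y → y ≤ ι n → Q y
    below zero {n} y 0≤y y≤n = above n y (subst (0# ≤_) (+-identityˡ y) 0≤y) y≤n
    below (suc m) {n} y 0≤ y≤n = down y (below m {suc n} (y + 1#) (subst (0# ≤_) (ι-shift m y) 0≤)
      (subst (_≤ ι (suc n)) (+-comm 1# y) (+-mono-≤ ≤-refl y≤n)))

  -- Only the natural bound is under double negation: once it is given, the decidable order allows a
  -- downward search.
  floor : ∀ x → 0# ≤ x → ¬ ¬ (∃[ n ] (ι n ≤ x × x < ι (suc n)))
  floor x 0≤x ¬∃ = archimedean x λ (n , x≤n) → ¬∃ (search n (≤-<-trans x≤n (≰⇒> λ le →
      <⇒≱ 0<1 (+-cancelʳ-≤ (ι n) (subst (1# + ι n ≤_) (sym (+-identityˡ _)) le)))))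
    where
    search : ∀ n → x < ι (suc n) → ∃[ n ] (ι n ≤ x × x < ι (suc n))
    search zero    x< = 0 , 0≤x , x<
    search (suc n) x< with ≤-<-dec (ι (suc n)) x
    ... | inj₁ le = suc n , le , x<
    ... | inj₂ gt = search n gt

  private
    -- Behind this and the next lemmas: the exponents `(i - j) / p` and `(i′ - j′) / q` are added
    -- over the denominator `p q`, with subtractions moved across because `_^_` takes natural
    -- exponents.
    common-denominator : ∀ p q j j′ x y →
      (p * x + j) * q + (q * y + j′) * p ≡ p * q * (x + y) + (j * q + j′ * p)
    common-denominator p q j j′ x y = begin
      (p * x + j) * q + (q * y + j′) * p
          ≡⟨ cong₂ _+_ (one p q x j) (trans (one q p y j′)
              (cong (λ u → u * y + j′ * p) (*-comm q p))) ⟩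
      (p * q * x + j * q) + (p * q * y + j′ * p) ≡⟨ +-interchange _ _ _ _ ⟩
      (p * q * x + p * q * y) + (j * q + j′ * p) ≡⟨ cong (_+ (j * q + j′ * p)) (distribˡ (p * q) x y) ⟨
      p * q * (x + y) + (j * q + j′ * p)        ∎
      where
      open ≡-Reasoning
      one : ∀ p q x j → (p * x + j) * q ≡ p * q * x + j * q
      one = solve 4 (λ p q x j → (p :* x :+ j) :* q := p :* q :* x :+ j :* q) refl

    ι-common-denominator : ∀ p q i i′ → ι (i ℕ.* q ℕ.+ i′ ℕ.* p) ≡ ι i * ι q + ι i′ * ι p
    ι-common-denominator p q i i′ = trans (ι-+ (i ℕ.* q) (i′ ℕ.* p)) (cong₂ _+_ (ι-* i q) (ι-* i′ p))

    ^-common-denominator : ∀ b p q i i′ → b ^ (i ℕ.* q ℕ.+ i′ ℕ.* p) ≡ (b ^ i) ^ q * (b ^ i′) ^ p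
    ^-common-denominator b p q i i′ = trans (^-homo-* b (i ℕ.* q) (i′ ℕ.* p))
        (sym (cong₂ _*_ (^-assocʳ b i q) (^-assocʳ b i′ p)))

    add-exponents : ∀ p q i j i′ j′ {x y} → ι i ≤ ι p * x + ι j → ι i′ ≤ ι q * y + ι j′ →
      ι (i ℕ.* q ℕ.+ i′ ℕ.* p) ≤ ι (p ℕ.* q) * (x + y) + ι (j ℕ.* q ℕ.+ j′ ℕ.* p)
    add-exponents p q i j i′ j′ {x} {y} i≤ i′≤ = begin
      ι (i ℕ.* q ℕ.+ i′ ℕ.* p)                            ≡⟨ ι-common-denominator p q i i′ ⟩
      ι i * ι q + ι i′ * ι p
          ≤⟨ +-mono-≤ (*-monoˡ-≤ (ι-nonNeg q) i≤) (*-monoˡ-≤ (ι-nonNeg p) i′≤) ⟩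
      (ι p * x + ι j) * ι q + (ι q * y + ι j′) * ι p      ≡⟨ common-denominator (ι p) (ι q) (ι j) (ι j′) x y ⟩
      ι p * ι q * (x + y) + (ι j * ι q + ι j′ * ι p)
          ≡⟨ cong₂ (λ u v → u * (x + y) + v) (ι-* p q) (ι-common-denominator p q j j′) ⟨
      ι (p ℕ.* q) * (x + y) + ι (j ℕ.* q ℕ.+ j′ ℕ.* p)    ∎
      where open ≤-Reasoning

    multiply-powers : ∀ p q i j i′ j′ {b s t} → 0# ≤ b → 0# ≤ s → 0# ≤ t →
      s ^ p * b ^ j ≤ b ^ i → t ^ q * b ^ j′ ≤ b ^ i′ →
      (s * t) ^ (p ℕ.* q) * b ^ (j ℕ.* q ℕ.+ j′ ℕ.* p) ≤ b ^ (i ℕ.* q ℕ.+ i′ ℕ.* p)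
    multiply-powers p q i j i′ j′ {b} {s} {t} 0≤b 0≤s 0≤t sᵖ≤ tᵠ≤ = begin
      (s * t) ^ (p ℕ.* q) * b ^ (j ℕ.* q ℕ.+ j′ ℕ.* p)
        ≡⟨ cong₂ _*_ (^-distrib-* s t (p ℕ.* q)) (^-common-denominator b p q j j′) ⟩
      (s ^ (p ℕ.* q) * t ^ (p ℕ.* q)) * ((b ^ j) ^ q * (b ^ j′) ^ p)
        ≡⟨ cong (_* ((b ^ j) ^ q * (b ^ j′) ^ p))
            (cong₂ _*_ (^-assocʳ s p q) (trans (^-assocʳ t q p) (cong (t ^_) (ℕₚ.*-comm q p)))) ⟨
      ((s ^ p) ^ q * (t ^ q) ^ p) * ((b ^ j) ^ q * (b ^ j′) ^ p)
        ≡⟨ *-interchange ((s ^ p) ^ q) ((t ^ q) ^ p) ((b ^ j) ^ q) ((b ^ j′) ^ p) ⟩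
      ((s ^ p) ^ q * (b ^ j) ^ q) * ((t ^ q) ^ p * (b ^ j′) ^ p)
        ≡⟨ cong₂ _*_ (^-distrib-* (s ^ p) (b ^ j) q) (^-distrib-* (t ^ q) (b ^ j′) p) ⟨
      (s ^ p * b ^ j) ^ q * (t ^ q * b ^ j′) ^ p
        ≤⟨ *-mono-≤ (^-nonNeg q 0≤ˢ) (^-nonNeg p 0≤ᵗ) (^-mono-≤ q 0≤ˢ sᵖ≤) (^-mono-≤ p 0≤ᵗ tᵠ≤) ⟩
      (b ^ i) ^ q * (b ^ i′) ^ p
        ≡⟨ ^-common-denominator b p q i i′ ⟨
      b ^ (i ℕ.* q ℕ.+ i′ ℕ.* p) ∎
      where
      open ≤-Reasoning
      0≤ˢ : 0# ≤ s ^ p * b ^ j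
      0≤ˢ = *-nonNeg (^-nonNeg p 0≤s) (^-nonNeg j 0≤b)
      0≤ᵗ : 0# ≤ t ^ q * b ^ j′
      0≤ᵗ = *-nonNeg (^-nonNeg q 0≤t) (^-nonNeg j′ 0≤b)

    multiply-exponent : ∀ m p i j x → ι i ≤ ι p * (ι m * x) + ι j → ι i ≤ ι (m ℕ.* p) * x + ι j
    multiply-exponent m p i j x = subst (λ z → ι i ≤ z + ι j) (begin
      ι p * (ι m * x)   ≡⟨ *-assoc (ι p) (ι m) x ⟨
      ι p * ι m * x     ≡⟨ cong (_* x) (*-comm (ι p) (ι m)) ⟩
      ι m * ι p * x     ≡⟨ cong (_* x) (ι-* m p) ⟨
      ι (m ℕ.* p) * x   ∎)
      where open ≡-Reasoning

    -- This passes from the exponent `(i - j) / p` to `(i - j) / (m p)`; the same `i` and `j` serve.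
    root-power : ∀ m p i j {b w t} → 0# ≤ b → 0# ≤ w → w ^ m ≤ t → t ^ p * b ^ j ≤ b ^ i →
      w ^ (m ℕ.* p) * b ^ j ≤ b ^ i
    root-power m p i j {b} {w} {t} 0≤b 0≤w wᵐ≤t tᵖ≤ = begin
      w ^ (m ℕ.* p) * b ^ j ≡⟨ cong (_* b ^ j) (^-assocʳ w m p) ⟨
      (w ^ m) ^ p * b ^ j   ≤⟨ *-monoˡ-≤ (^-nonNeg j 0≤b) (^-mono-≤ p (^-nonNeg m 0≤w) wᵐ≤t) ⟩
      t ^ p * b ^ j         ≤⟨ tᵖ≤ ⟩
      b ^ i                 ∎
      where open ≤-Reasoning

  module Supremum {b : ℝ} (1≤b : 1# ≤ b) where
    0<b : 0# < b
    0<b = <-≤-trans 0<1 1≤b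

    0≤b : 0# ≤ b
    0≤b = <⇒≤ 0<b

    S : ℝ → Pred ℝ 0ℓ
    S = PowersBelow b

    P : ℝ → ℝ
    P x = sup (S x)

    -- `i ≤ M (k + 1) + j` holds already in ℕ, so `b ^ i` is at most `(b ^ M) ^ suc k * b ^ j`; then
    -- `b ^ j` and the power `suc k` cancel.
    member≤ : ∀ M {x t} → x ≤ ι M → t ∈ S x → t ≤ b ^ M
    member≤ M {x} {t} x≤M (0≤t , i , j , k , i≤ , tᵏ≤) =
      ^-cancel-≤ k (^-nonNeg M 0≤b) $ *-cancelʳ-≤ (^-pos j 0<b) $ ≤-trans tᵏ≤ $
      subst (b ^ i ≤_) power (^-mono-exp 1≤b i≤ℕ)
      where
      i≤ℕ : i ℕ.≤ M ℕ.* suc k ℕ.+ j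
      i≤ℕ = ι-cancel (≤-trans i≤ (subst (_ ≤_)
        (sym (trans (ι-+ (M ℕ.* suc k) j) (cong (_+ ι j) (trans (ι-* M (suc k)) (*-comm _ _)))))
        (+-monoˡ-≤ (ι j) (*-monoʳ-≤ (ι-nonNeg (suc k)) x≤M))))
      power : b ^ (M ℕ.* suc k ℕ.+ j) ≡ (b ^ M) ^ suc k * b ^ j
      power = trans (^-homo-* b (M ℕ.* suc k) j) (cong (_* b ^ j) (sym (^-assocʳ b M (suc k))))

    inhabited : ∀ x → ¬ ¬ Satisfiable (S x)
    -- 0 is a member as soon as some rational exponent lies below `x`; here it is `- j` with
    -- denominator 1.
    inhabited x ¬S = archimedean (- x) λ (j , -x≤j) → ¬S (0# , ≤-refl , 0 , j , 0 ,
      subst (0# ≤_) (solve 2 (λ x j → j :- :- x := (:1 :+ :0) :* x :+ j) refl x (ι j)) (≤⇒0≤- -x≤j) ,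
      ≤-trans (≤-reflexive (trans (cong (_* b ^ j) (zeroˡ _)) (zeroˡ _))) 0≤1)

    bounded : ∀ x → ¬ ¬ Satisfiable (UpperBound (S x))
    bounded x ¬B = archimedean x λ (M , x≤M) → ¬B (b ^ M , member≤ M x≤M)

    -- `sup-upper` and `sup-least` ask for a bound and a member that exist only up to double
    -- negation; here and in `P≤` the stability of `_≤_` removes it.
    ≤P : ∀ {x t} → t ∈ S x → t ≤ P x
    ≤P {x} {t} t∈ = ≤-stable λ t≰ → bounded x λ B → t≰ (sup-upper (S x) (t , t∈) B t∈)

    P≤ : ∀ {x c} → (∀ {t} → t ∈ S x → t ≤ c) → P x ≤ c
    P≤ {x} bound = ≤-stable λ P≰ → inhabited x λ I → P≰ (sup-least (S x) I bound)

    P-mono : ∀ {x y} → x ≤ y → P x ≤ P y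
    P-mono {x} {y} x≤y = P≤ λ (0≤t , i , j , k , i≤ , tᵏ≤) → ≤P {y} (0≤t , i , j , k ,
      ≤-trans i≤ (+-monoˡ-≤ (ι j) (*-monoʳ-≤ (ι-nonNeg (suc k)) x≤y)) , tᵏ≤)

    P-nonNeg : ∀ x → 0# ≤ P x
    P-nonNeg x = ≤-stable λ P≰ → inhabited x λ (t , t∈) → P≰ (≤-trans (proj₁ t∈) (≤P t∈))

    P1≡b : P 1# ≡ b
    P1≡b = ≤-antisym
      (P≤ λ {t} t∈ → subst (t ≤_) (*-identityʳ b) (member≤ 1 (≤-reflexive (sym ι-1)) t∈))
      (≤P (0≤b , 1 , 0 , 0 , ≤-reflexive (solve 0 (:1 :+ :0 := (:1 :+ :0) :* :1 :+ :0) refl) ,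
          ≤-reflexive (*-identityʳ _)))

    1≤P0 : 1# ≤ P 0#
    1≤P0 = ≤P (0≤1 , 0 , 0 , 0 , ≤-reflexive (solve 0 (:0 := (:1 :+ :0) :* :0 :+ :0) refl) ,
      ≤-reflexive (solve 0 (:1 :* :1 :* :1 := :1) refl))

    P0≤1 : P 0# ≤ 1#
    P0≤1 = P≤ (member≤ 0 ≤-refl)

    b⁻¹≤P-1 : b ⁻¹ ≤ P (- 1#)
    b⁻¹≤P-1 = ≤P (<⇒≤ (inv-pos 0<b) , 0 , 1 , 0 ,
      ≤-reflexive (solve 0 (:0 := (:1 :+ :0) :* (:- :1) :+ (:1 :+ :0)) refl) ,
      ≤-reflexive (by-unit (inverseˡ 0<b) (λ z → z)
        (solve 2 (λ b c → c :* :1 :* (b :* :1) := c :* b) refl b (b ⁻¹)) refl))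

    -- Division by `u` reduces this to `P≤`; for `u` equal to 0 the hypothesis `0# ≤ c` takes over.
    *P≤ : ∀ {u c x} → 0# ≤ u → 0# ≤ c → (∀ {t} → t ∈ S x → u * t ≤ c) → u * P x ≤ c
    *P≤ {u} {c} {x} 0≤u 0≤c bound with u ≟ 0#
    ... | yes refl = subst (_≤ c) (sym (zeroˡ _)) 0≤c
    ... | no  u≢0 = subst₂ _≤_ (*-comm _ _) (/-cancel 0<u) (*-monoˡ-≤ 0≤u
        (P≤ λ t∈ → ≤-/ 0<u (subst (_≤ c) (*-comm _ _) (bound t∈))))
      where
      0<u : 0# < u
      0<u = 0≤u , u≢0 ∘ sym

    S-* : ∀ {x y s t} → s ∈ S x → t ∈ S y → s * t ∈ S (x + y)
    S-* (0≤s , i , j , k , i≤ , sᵏ≤) (0≤t , i′ , j′ , k′ , i′≤ , tᵏ≤) =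
      -- `PowersBelow` stores the denominator minus one: `suc k * suc k′` reduces to the successor
      -- of the last witness.
      *-nonNeg 0≤s 0≤t , i ℕ.* suc k′ ℕ.+ i′ ℕ.* suc k , j ℕ.* suc k′ ℕ.+ j′ ℕ.* suc k , k′ ℕ.+ k ℕ.* suc k′ ,
      add-exponents (suc k) (suc k′) i j i′ j′ i≤ i′≤ ,
      multiply-powers (suc k) (suc k′) i j i′ j′ 0≤b 0≤s 0≤t sᵏ≤ tᵏ≤

    -- Only this half of the exponential law comes directly from products of members; the other half
    -- goes through `P-inverse`.
    P-super : ∀ x y → P x * P y ≤ P (x + y)
    P-super x y = *P≤ (P-nonNeg x) (P-nonNeg _) λ {t} t∈ → subst (_≤ P (x + y)) (*-comm _ _)
      (*P≤ (proj₁ t∈) (P-nonNeg _) λ {s} s∈ → subst (_≤ P (x + y)) (*-comm _ _) (≤P (S-* s∈ t∈)))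

    -- A member `t` above `P x ^ suc m` would leave room for some `w` above `P x` with
    -- `w ^ suc m ≤ t`; but such a `w` is itself a member of `S x`.
    P-multiple : ∀ m x → P (ι (suc m) * x) ≤ P x ^ suc m
    P-multiple m x = P≤ bound
      where
      bound : ∀ {t} → t ∈ S (ι (suc m) * x) → t ≤ P x ^ suc m
      bound {t} (0≤t , i , j , k , i≤ , tᵏ≤) = [ (λ le → le) , (λ gt →
        contradiction-from (^-right-continuous (suc m) (P-nonNeg x) gt)) ]′ (≤-<-dec t (P x ^ suc m))
        where
        contradiction-from : ∃[ w ] (P x < w × w ^ suc m ≤ t) → t ≤ P x ^ suc m
        contradiction-from (w , P<w , wᵐ≤t) = contradiction (≤P w∈) (<⇒≱ P<w)
          where
          0≤w : 0# ≤ w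
          0≤w = ≤-trans (P-nonNeg x) (<⇒≤ P<w)
          w∈ : w ∈ S x
          w∈ = 0≤w , i , j , k ℕ.+ m ℕ.* suc k , multiply-exponent (suc m) (suc k) i j x i≤ ,
            root-power (suc m) (suc k) i j 0≤b 0≤w wᵐ≤t tᵏ≤

    Q : ℝ → Set
    Q y = b ⁻¹ ≤ P y * P (- y)

    -- The product P y * P (- y) does not decrease under y ↦ y ± 1, so it is
    -- bounded below on all of ℝ by its lower bound on [0 , 1].
    inverse-bound : ∀ y → Q y
    inverse-bound = translation-induction {Q} (λ _ → ≤-stable) unit step down
      where
      eq : ∀ y → - (y + 1#) + 1# ≡ - y
      eq y = solve 1 (λ y → :- (y :+ :1) :+ :1 := :- y) refl y
      flip : ∀ y → Q y → Q (- y)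
      flip y le = subst (λ z → b ⁻¹ ≤ P (- y) * P z) (sym (-‿involutive y))
          (subst (b ⁻¹ ≤_) (*-comm (P y) (P (- y))) le)
      -- The origin of the constant: on the unit interval `P s` is at least `P 0#`, hence 1, and
      -- `P (- s)` is at least `P (- 1#)`, hence `b ⁻¹`.
      unit : ∀ s → 0# ≤ s → s ≤ 1# → b ⁻¹ ≤ P s * P (- s)
      unit s 0≤s s≤1 = subst (_≤ P s * P (- s)) (*-identityˡ _) (*-mono-≤ 0≤1 (<⇒≤ (inv-pos 0<b))
        (≤-trans 1≤P0 (P-mono 0≤s)) (≤-trans b⁻¹≤P-1 (P-mono (neg-mono-≤ s≤1))))
      step : ∀ y → Q y → Q (y + 1#)
      step y le = begin
        b ⁻¹                              ≤⟨ le ⟩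
        P y * P (- y)                     ≡⟨ *-identityʳ _ ⟨
        P y * P (- y) * 1#                ≡⟨ cong (P y * P (- y) *_) (inverse 0<b) ⟨
        P y * P (- y) * (b * b ⁻¹)        ≡⟨ solve 4
            (λ p q b c → p :* q :* (b :* c) := (p :* b) :* (q :* c)) refl (P y) (P (- y)) b (b ⁻¹) ⟩
        P y * b * (P (- y) * b ⁻¹)        ≡⟨ cong (λ z → P y * z * (P (- y) * b ⁻¹)) P1≡b ⟨
        P y * P 1# * (P (- y) * b ⁻¹)     ≤⟨ *-mono-≤ (*-nonNeg (P-nonNeg y) (P-nonNeg 1#))
            (*-nonNeg (P-nonNeg (- y)) (<⇒≤ (inv-pos 0<b)))
                                               (P-super y 1#) (*-monoʳ-≤ (P-nonNeg (- y)) b⁻¹≤P-1) ⟩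
        P (y + 1#) * (P (- y) * P (- 1#)) ≤⟨ *-monoʳ-≤ (P-nonNeg (y + 1#)) (P-super (- y) (- 1#)) ⟩
        P (y + 1#) * P (- y + - 1#)       ≡⟨ cong (λ z → P (y + 1#) * P z) (-‿+-comm y 1#) ⟩
        P (y + 1#) * P (- (y + 1#))       ∎
        where open ≤-Reasoning
      -- The product is unchanged under negation of `y`, so the step down to `y` is the step up from
      -- `- (y + 1#)`.
      down : ∀ y → Q (y + 1#) → Q y
      down y le = subst Q (-‿involutive y) (flip (- y)
          (subst Q (eq y) (step (- (y + 1#)) (flip (y + 1#) le))))

    -- `P-super` gives `q ≤ 1#`. Conversely every positive power of `q` dominates a product
    -- `P (m * x) * P (- (m * x))`, hence `b ⁻¹`; so the powers of `q ⁻¹` stay below `b`, and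
    -- `bounded-powers` discards that constant.
    P-inverse : ∀ x → P x * P (- x) ≡ 1#
    P-inverse x = ≤-antisym (≤-trans (P-super x (- x)) (subst (λ z → P z ≤ 1#) (sym (-‿inverseʳ x)) P0≤1)) 1≤q
      where
      q : ℝ
      q = P x * P (- x)
      0<q : 0# < q
      0<q = <-≤-trans (inv-pos 0<b) (inverse-bound x)
      powers : ∀ n → b ⁻¹ ≤ q ^ n
      powers zero = subst₂ _≤_ (*-identityˡ _) (inverse 0<b) (*-monoˡ-≤ (<⇒≤ (inv-pos 0<b)) 1≤b)
      powers (suc n) = begin
        b ⁻¹                                        ≤⟨ inverse-bound (m * x) ⟩
        P (m * x) * P (- (m * x))                   ≡⟨ cong (λ z → P (m * x) * P z) (-‿distribʳ-* m x) ⟩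
        P (m * x) * P (m * - x)
            ≤⟨ *-mono-≤ (P-nonNeg (m * x)) (P-nonNeg (m * - x)) (P-multiple n x)
                (P-multiple n (- x)) ⟩
        P x ^ suc n * P (- x) ^ suc n               ≡⟨ ^-distrib-* (P x) (P (- x)) (suc n) ⟨
        q ^ suc n                                   ∎
        where
        open ≤-Reasoning
        m : ℝ
        m = ι (suc n)
      unit : ∀ n → 1# ≡ (q ⁻¹) ^ n * q ^ n
      unit n = sym (trans (sym (^-distrib-* (q ⁻¹) q n)) (trans (cong (_^ n) (inverseˡ 0<q)) (1^n≡1 n)))
      inverse-powers : ∀ n → (q ⁻¹) ^ n ≤ b
      inverse-powers n = *-cancelʳ-≤ {q ^ n} (^-pos n 0<q) (begin
        (q ⁻¹) ^ n * q ^ n ≡⟨ unit n ⟨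
        1#                 ≡⟨ inverse 0<b ⟨
        b * b ⁻¹           ≤⟨ *-monoʳ-≤ 0≤b (powers n) ⟩
        b * q ^ n          ∎)
        where open ≤-Reasoning
      1≤q : 1# ≤ q
      1≤q = subst (1# ≤_) (inv-involutive 0<q)
          (one≤inv (inv-pos 0<q) (bounded-powers {q ⁻¹} {b} inverse-powers))

    P-pos : ∀ x → 0# < P x
    P-pos x = P-nonNeg x , λ 0≡P → 0≢1 (trans (sym (zeroˡ _)) (trans (cong (_* P (- x)) 0≡P) (P-inverse x)))

    -- For the missing half, `P-super` is applied to `x + y` and `- y`, and the factor `P (- y)`,
    -- inverse to `P y`, is cancelled.
    P-homo : ∀ x y → P (x + y) ≡ P x * P y
    P-homo x y = ≤-antisym (*-cancelʳ-≤ (P-pos (- y)) (≤-trans (P-super (x + y) (- y)) (≤-reflexive (begin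
        P (x + y + - y)        ≡⟨ cong P (solve 2 (λ x y → x :+ y :+ :- y := x) refl x y) ⟩
        P x                    ≡⟨ *-identityʳ _ ⟨
        P x * 1#               ≡⟨ cong (P x *_) (P-inverse y) ⟨
        P x * (P y * P (- y))  ≡⟨ *-assoc _ _ _ ⟨
        P x * P y * P (- y)    ∎)))) (P-super x y)
      where open ≡-Reasoning

-- Exponential functions and the laws of real powers.

module PowerLaws (R : CompleteOrderedField) where
  open OrderedField R
  open RealPowers R

  -- Boundedness takes the place of monotonicity because it passes at once to products, even of a
  -- rising and a falling function. The interval from 0 to `x` is parametrised by `s`, which covers
  -- both signs of `x` and is compatible with rescaling.
  record IsExponential (E : ℝ → ℝ) (b : ℝ) : Set where
    field
      positive : ∀ x → 0# < E x
      homo     : ∀ x y → E (x + y) ≡ E x * E y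
      base     : E 1# ≡ b
      bounded  : ∀ x → ∃[ M ] (∀ s → 0# ≤ s → s ≤ 1# → E (x * s) ≤ M)

    at-0 : E 0# ≡ 1#
    at-0 = *-cancelˡ-≡ (positive 0#) (trans (sym (homo 0# 0#))
        (trans (cong E (+-identityˡ 0#)) (sym (*-identityʳ _))))

    inverse-at : ∀ x → E x * E (- x) ≡ 1#
    inverse-at x = trans (sym (homo x (- x))) (trans (cong E (-‿inverseʳ x)) at-0)

    at-neg : ∀ x → E (- x) ≡ E x ⁻¹
    at-neg x = inv-unique (positive x) (inverse-at x)

    at-multiple : ∀ n x → E (ι n * x) ≡ E x ^ n
    at-multiple zero    x = trans (cong E (zeroˡ x)) at-0
    at-multiple (suc n) x = begin
      E ((1# + ι n) * x)     ≡⟨ cong E (trans (distribʳ x 1# (ι n)) (cong (_+ ι n * x) (*-identityˡ x))) ⟩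
      E (x + ι n * x)        ≡⟨ homo x (ι n * x) ⟩
      E x * E (ι n * x)      ≡⟨ cong (E x *_) (at-multiple n x) ⟩
      E x * E x ^ n          ∎
      where open ≡-Reasoning

  open IsExponential

  const-1 : IsExponential (λ _ → 1#) 1#
  const-1 = record { positive = λ _ → 0<1 ; homo = λ _ _ → sym (*-identityˡ 1#) ; base = refl
    ; bounded = λ _ → 1# , λ _ _ _ → ≤-refl }

  product : ∀ {E F a b} → IsExponential E a → IsExponential F b → IsExponential (λ x → E x * F x) (a * b)
  product {E} {F} e f = record
    { positive = λ x → 0<-* (positive e x) (positive f x)
    ; homo     = λ x y → trans (cong₂ _*_ (homo e x y) (homo f x y)) (*-interchange _ _ _ _)
    ; base     = cong₂ _*_ (base e) (base f)
    ; bounded  = λ x → proj₁ (bounded e x) * proj₁ (bounded f x) , λ s 0≤s s≤1 →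
        *-mono-≤ (<⇒≤ (positive e (x * s))) (<⇒≤ (positive f (x * s)))
          (proj₂ (bounded e x) s 0≤s s≤1) (proj₂ (bounded f x) s 0≤s s≤1)
    }

  rescale : ∀ {E b} c → IsExponential E b → IsExponential (λ x → E (c * x)) (E c)
  rescale {E} c e = record
    { positive = λ x → positive e (c * x)
    ; homo     = λ x y → trans (cong E (distribˡ c x y)) (homo e (c * x) (c * y))
    ; base     = cong E (*-identityʳ c)
    ; bounded  = λ x → proj₁ (bounded e (c * x)) , λ s 0≤s s≤1 →
        subst (λ z → E z ≤ proj₁ (bounded e (c * x))) (*-assoc c x s) (proj₂ (bounded e (c * x)) s 0≤s s≤1)
    }

  reflect : ∀ {E b} → IsExponential E b → IsExponential (λ x → E (- x)) (b ⁻¹)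
  reflect {E} {b} e = record
    { positive = λ x → positive e (- x)
    ; homo     = λ x y → trans (cong E (sym (-‿+-comm x y))) (homo e (- x) (- y))
    ; base     = trans (at-neg e 1#) (cong _⁻¹ (base e))
    ; bounded  = λ x → proj₁ (bounded e (- x)) , λ s 0≤s s≤1 →
        subst (λ z → E z ≤ proj₁ (bounded e (- x))) (sym (-‿distribˡ-* x s))
            (proj₂ (bounded e (- x)) s 0≤s s≤1)
    }

  -- An exponential with base 1 has period 1, hence is bounded, and so are the
  -- powers of its values.
  base-1-≤1 : ∀ {D} → IsExponential D 1# → ∀ x → D x ≤ 1#
  base-1-≤1 {D} d x = bounded-powers {D x} {M} λ n → subst (_≤ M) (at-multiple d n x) (D≤M (ι n * x))
    where
    M : ℝ
    M = proj₁ (bounded d 1#)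
    periodic : ∀ y → D (y + 1#) ≡ D y
    periodic y = trans (homo d y 1#) (trans (cong (D y *_) (base d)) (*-identityʳ (D y)))
    D≤M : ∀ y → D y ≤ M
    D≤M = translation-induction {λ y → D y ≤ M} (λ _ → ≤-stable)
      (λ s 0≤s s≤1 → subst (λ z → D z ≤ M) (*-identityˡ s) (proj₂ (bounded d 1#) s 0≤s s≤1))
      (λ y → subst (_≤ M) (sym (periodic y))) (λ y → subst (_≤ M) (periodic y))

  -- The quotient of `E` by `F`, written as a product with the reflection of `F`, is an exponential
  -- with base 1.
  unique-≤ : ∀ {E F b} → 0# < b → IsExponential E b → IsExponential F b → ∀ x → E x ≤ F x
  unique-≤ {E} {F} {b} 0<b e f x = *-cancelʳ-≤ (positive f (- x))
      (subst (E x * F (- x) ≤_) (sym (inverse-at f x))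
    (base-1-≤1 (subst (IsExponential _) (inverse 0<b) (product e (reflect f))) x))

  unique : ∀ {E F b} → 0# < b → IsExponential E b → IsExponential F b → ∀ x → E x ≡ F x
  unique 0<b e f x = ≤-antisym (unique-≤ 0<b e f x) (unique-≤ 0<b f e x)

  module _ {b : ℝ} (1≤b : 1# ≤ b) where
    open Supremum 1≤b

    sup-exponential : IsExponential P b
    sup-exponential = record
      { positive = P-pos ; homo = P-homo ; base = P1≡b
      -- One bound for both signs of `x`: `P (x * s)` is at most `P x` if `x ≥ 0` and at most 1 if
      -- `x ≤ 0`.
      ; bounded = λ x → P x + 1# , λ s 0≤s s≤1 → [
          (λ 0≤x → ≤-trans (P-mono (x*s≤x x s 0≤x s≤1)) (x≤x+1 (P x)))
        , (λ x≤0 → ≤-trans (P-mono (x*s≤0 x s x≤0 0≤s))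
            (≤-trans P0≤1 (≤-by (P-nonNeg x) (+-comm _ _)))) ]′ (≤-total 0# x) }
      where
      x*s≤x : ∀ x s → 0# ≤ x → s ≤ 1# → x * s ≤ x
      x*s≤x x s 0≤x s≤1 = subst (x * s ≤_) (*-identityʳ x) (*-monoʳ-≤ 0≤x s≤1)
      x*s≤0 : ∀ x s → x ≤ 0# → 0# ≤ s → x * s ≤ 0#
      x*s≤0 x s x≤0 0≤s = subst (x * s ≤_) (zeroˡ s) (*-monoˡ-≤ 0≤s x≤0)

    ^ᴿ-1≤ : ∀ x → b ^ᴿ x ≡ P x
    ^ᴿ-1≤ x with b ≤? 0# | 1# ≤? b
    ... | yes b≤0 | _       = contradiction b≤0 (<⇒≱ 0<b)
    ... | no  _   | yes _   = refl
    ... | no  _   | no  1≰b = contradiction 1≤b 1≰b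

    ^ᴿ-mono-exp : ∀ {x y} → x ≤ y → b ^ᴿ x ≤ b ^ᴿ y
    ^ᴿ-mono-exp {x} {y} x≤y = subst₂ _≤_ (sym (^ᴿ-1≤ x)) (sym (^ᴿ-1≤ y)) (P-mono x≤y)

  transport : ∀ {E F b} → (∀ x → F x ≡ E x) → IsExponential E b → IsExponential F b
  transport {E} {F} F≡E e = record
    { positive = λ x → subst (0# <_) (sym (F≡E x)) (positive e x)
    ; homo     = λ x y → trans (F≡E _) (trans (homo e x y) (sym (cong₂ _*_ (F≡E x) (F≡E y))))
    ; base     = trans (F≡E 1#) (base e)
    ; bounded  = λ x → proj₁ (bounded e x) , λ s 0≤s s≤1 →
        subst (_≤ proj₁ (bounded e x)) (sym (F≡E (x * s))) (proj₂ (bounded e x) s 0≤s s≤1)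
    }

  ^ᴿ-<1 : ∀ {b} (0<b : 0# < b) (b<1 : b < 1#) x → b ^ᴿ x ≡ sup (PowersBelow (b ⁻¹) x) ⁻¹
  ^ᴿ-<1 {b} 0<b b<1 x with b ≤? 0# | 1# ≤? b
  ... | yes b≤0 | _       = contradiction b≤0 (<⇒≱ 0<b)
  ... | no  _   | yes 1≤b = contradiction 1≤b (<⇒≱ b<1)
  ... | no  _   | no  _   = refl

  ^ᴿ-exponential : ∀ {b} → 0# < b → IsExponential (b ^ᴿ_) b
  ^ᴿ-exponential {b} 0<b = [ (λ 1≤b → transport (^ᴿ-1≤ 1≤b) (sup-exponential 1≤b)) , below ]′ (≤-<-dec 1# b)
    where
    -- For `b < 1` the definition inverts a power of `b ⁻¹`. This inverse is the reflection of that
    -- exponential, whose base is `(b ⁻¹) ⁻¹`.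
    below : b < 1# → IsExponential (b ^ᴿ_) b
    below b<1 = subst (IsExponential (b ^ᴿ_)) (inv-involutive 0<b)
      (transport (λ x → trans (^ᴿ-<1 0<b b<1 x) (sym (at-neg e x))) (reflect e))
      where
      e : IsExponential (λ x → sup (PowersBelow (b ⁻¹) x)) (b ⁻¹)
      e = sup-exponential (one≤inv 0<b (<⇒≤ b<1))

  ^ᴿ-pos : ∀ {b} x → 0# < b → 0# < b ^ᴿ x
  ^ᴿ-pos x 0<b = positive (^ᴿ-exponential 0<b) x

  ^ᴿ-homo : ∀ {b} x y → 0# < b → b ^ᴿ (x + y) ≡ b ^ᴿ x * b ^ᴿ y
  ^ᴿ-homo x y 0<b = homo (^ᴿ-exponential 0<b) x y

  ^ᴿ-1 : ∀ {b} → 0# < b → b ^ᴿ 1# ≡ b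
  ^ᴿ-1 0<b = base (^ᴿ-exponential 0<b)

  ^ᴿ-0 : ∀ {b} → 0# < b → b ^ᴿ 0# ≡ 1#
  ^ᴿ-0 0<b = at-0 (^ᴿ-exponential 0<b)

  1^ᴿ : ∀ x → 1# ^ᴿ x ≡ 1#
  1^ᴿ = unique 0<1 (^ᴿ-exponential 0<1) const-1

  ^ᴿ-distrib-* : ∀ {a b} x → 0# < a → 0# < b → (a * b) ^ᴿ x ≡ a ^ᴿ x * b ^ᴿ x
  ^ᴿ-distrib-* x 0<a 0<b = unique (0<-* 0<a 0<b) (^ᴿ-exponential (0<-* 0<a 0<b))
    (product (^ᴿ-exponential 0<a) (^ᴿ-exponential 0<b)) x

  ^ᴿ-assoc : ∀ {b} x y → 0# < b → (b ^ᴿ x) ^ᴿ y ≡ b ^ᴿ (x * y)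
  ^ᴿ-assoc x y 0<b = unique (^ᴿ-pos x 0<b) (^ᴿ-exponential (^ᴿ-pos x 0<b)) (rescale x (^ᴿ-exponential 0<b)) y

  0^ᴿ : ∀ {x} → x ≢ 0# → 0# ^ᴿ x ≡ 0#
  0^ᴿ {x} x≢0 with 0# ≤? 0# | x ≟ 0#
  ... | no 0≰0 | _       = contradiction ≤-refl 0≰0
  ... | yes _  | yes x≡0 = contradiction x≡0 x≢0
  ... | yes _  | no  _   = refl

  0^ᴿ0 : 0# ^ᴿ 0# ≡ 1#
  0^ᴿ0 with 0# ≤? 0# | 0# ≟ 0#
  ... | no 0≰0 | _     = contradiction ≤-refl 0≰0
  ... | yes _  | no 0≢0 = contradiction refl 0≢0
  ... | yes _  | yes _ = refl

  0≤⇒≡0⊎0< : ∀ {b} → 0# ≤ b → b ≡ 0# ⊎ 0# < b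
  0≤⇒≡0⊎0< {b} 0≤b with b ≟ 0#
  ... | yes b≡0 = inj₁ b≡0
  ... | no  b≢0 = inj₂ (0≤b , b≢0 ∘ sym)

  ^ᴿ0 : ∀ {b} → 0# ≤ b → b ^ᴿ 0# ≡ 1#
  ^ᴿ0 0≤b = [ (λ { refl → 0^ᴿ0 }) , ^ᴿ-0 ]′ (0≤⇒≡0⊎0< 0≤b)

  ^ᴿ-nonNeg : ∀ {b} x → 0# ≤ b → 0# ≤ b ^ᴿ x
  ^ᴿ-nonNeg {b} x 0≤b = [ at-zero , (λ 0<b → <⇒≤ (^ᴿ-pos x 0<b)) ]′ (0≤⇒≡0⊎0< 0≤b)
    where
    at-zero : b ≡ 0# → 0# ≤ b ^ᴿ x
    at-zero refl = [ (λ { refl → subst (0# ≤_) (sym 0^ᴿ0) 0≤1 }) , (λ x≢0 → ≤-reflexive (sym (0^ᴿ x≢0))) ]′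
      (toSum (x ≟ 0#))

  1≤^ᴿ : ∀ {b x} → 1# ≤ b → 0# ≤ x → 1# ≤ b ^ᴿ x
  1≤^ᴿ {b} {x} 1≤b 0≤x = subst (_≤ b ^ᴿ x) (^ᴿ-0 (<-≤-trans 0<1 1≤b)) (^ᴿ-mono-exp 1≤b 0≤x)

  -- For `a > 0`, `b ^ᴿ x` is `(b / a) ^ᴿ x * a ^ᴿ x` with `b / a ≥ 1`. Base 0 splits off since the
  -- power laws want positive bases, and there exponent 0 again, since `0# ^ᴿ 0#` is 1.
  ^ᴿ-mono-≤ : ∀ {a b x} → 0# ≤ x → 0# ≤ a → a ≤ b → a ^ᴿ x ≤ b ^ᴿ x
  ^ᴿ-mono-≤ {a} {b} {x} 0≤x 0≤a a≤b = [ at-zero , positive-base ]′ (0≤⇒≡0⊎0< 0≤a)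
    where
    at-zero : a ≡ 0# → a ^ᴿ x ≤ b ^ᴿ x
    at-zero refl = [ (λ { refl → ≤-reflexive (trans 0^ᴿ0 (sym (^ᴿ0 a≤b))) })
      , (λ x≢0 → subst (_≤ b ^ᴿ x) (sym (0^ᴿ x≢0)) (^ᴿ-nonNeg x a≤b)) ]′ (toSum (x ≟ 0#))
    positive-base : 0# < a → a ^ᴿ x ≤ b ^ᴿ x
    positive-base 0<a = begin
      a ^ᴿ x                ≡⟨ *-identityˡ _ ⟨
      1# * a ^ᴿ x           ≤⟨ *-monoˡ-≤ (<⇒≤ (^ᴿ-pos x 0<a)) (1≤^ᴿ 1≤b/a 0≤x) ⟩
      (b / a) ^ᴿ x * a ^ᴿ x ≡⟨ ^ᴿ-distrib-* x (<-≤-trans 0<1 1≤b/a) 0<a ⟨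
      (b / a * a) ^ᴿ x      ≡⟨ cong (_^ᴿ x) (/-cancel 0<a) ⟩
      b ^ᴿ x                ∎
      where
      open ≤-Reasoning
      1≤b/a : 1# ≤ b / a
      1≤b/a = ≤-/ 0<a (subst (_≤ b) (sym (*-identityˡ a)) a≤b)

  ^ᴿ-≤1 : ∀ {b x} → 0# ≤ b → b ≤ 1# → 0# ≤ x → b ^ᴿ x ≤ 1#
  ^ᴿ-≤1 {b} {x} 0≤b b≤1 0≤x = subst (b ^ᴿ x ≤_) (1^ᴿ x) (^ᴿ-mono-≤ 0≤x 0≤b b≤1)

  ^ᴿ-antimono-exp : ∀ {b x y} → 0# < b → b ≤ 1# → x ≤ y → b ^ᴿ y ≤ b ^ᴿ x
  ^ᴿ-antimono-exp {b} {x} {y} 0<b b≤1 x≤y = begin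
    b ^ᴿ y                  ≡⟨ cong (b ^ᴿ_) (solve 2 (λ x y → y := (y :- x) :+ x) refl x y) ⟩
    b ^ᴿ ((y - x) + x)      ≡⟨ ^ᴿ-homo (y - x) x 0<b ⟩
    b ^ᴿ (y - x) * b ^ᴿ x   ≤⟨ *-monoˡ-≤ (<⇒≤ (^ᴿ-pos x 0<b)) (^ᴿ-≤1 (<⇒≤ 0<b) b≤1 (≤⇒0≤- x≤y)) ⟩
    1# * b ^ᴿ x             ≡⟨ *-identityˡ _ ⟩
    b ^ᴿ x                  ∎
    where open ≤-Reasoning

  ^ᴿ-ι : ∀ {b} n → 0# < b → b ^ᴿ ι n ≡ b ^ n
  ^ᴿ-ι {b} n 0<b = trans (cong (b ^ᴿ_) (sym (*-identityʳ (ι n))))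
    (trans (at-multiple (^ᴿ-exponential 0<b) n 1#) (cong (_^ n) (^ᴿ-1 0<b)))

  ^ᴿ-inverse : ∀ {b x y} → 0# ≤ b → 0# < x → x * y ≡ 1# → (b ^ᴿ x) ^ᴿ y ≡ b
  ^ᴿ-inverse {b} {x} {y} 0≤b 0<x xy≡1 = [ at-zero ,
      (λ 0<b → trans (^ᴿ-assoc x y 0<b) (trans (cong (b ^ᴿ_) xy≡1) (^ᴿ-1 0<b))) ]′
    (0≤⇒≡0⊎0< 0≤b)
    where
    y≢0 : y ≢ 0#
    y≢0 y≡0 = 0≢1 (trans (sym (zeroʳ x)) (trans (cong (x *_) (sym y≡0)) xy≡1))
    at-zero : b ≡ 0# → (b ^ᴿ x) ^ᴿ y ≡ b
    at-zero refl = trans (cong (_^ᴿ y) (0^ᴿ (<⇒≢ 0<x))) (0^ᴿ y≢0)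

  private
    -- In other words, `(s ^ n - 1) / n` does not decrease with `n`. The induction multiplies by `s`
    -- and adds `(s ^ suc n - 1#) * (s - 1#)`, whose factors have the same sign.
    step-convex : ∀ {s} n → 0# ≤ s → 0# ≤ ι n * s ^ suc n + 1# - ι (suc n) * s ^ n
    step-convex {s} zero 0≤s = ≤-reflexive (solve 1
        (λ s → :0 := :0 :* (s :* :1) :+ :1 :- (:1 :+ :0) :* :1) refl s)
    step-convex {s} (suc n) 0≤s = subst (0# ≤_) (eq (ι n) s (s ^ n))
      (0≤-+ (*-nonNeg 0≤s (step-convex n 0≤s)) (diff-nonNeg (≤-total 1# s)))
      where
      eq : ∀ m s p → s * (m * (s * p) + 1# - (1# + m) * p) + (s * p - 1#) * (s - 1#) ≡
        (1# + m) * (s * (s * p)) + 1# - (1# + (1# + m)) * (s * p)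
      eq = solve 3 (λ m s p → s :* (m :* (s :* p) :+ :1 :- (:1 :+ m) :* p) :+ (s :* p :- :1) :* (s :- :1) :=
        (:1 :+ m) :* (s :* (s :* p)) :+ :1 :- (:1 :+ (:1 :+ m)) :* (s :* p)) refl
      diff-nonNeg : 1# ≤ s ⊎ s ≤ 1# → 0# ≤ (s * s ^ n - 1#) * (s - 1#)
      diff-nonNeg (inj₁ 1≤s) = *-nonNeg (≤⇒0≤- (1≤^ (suc n) 1≤s)) (≤⇒0≤- 1≤s)
      diff-nonNeg (inj₂ s≤1) = subst (0# ≤_) (solve 2
          (λ a s → (:1 :- a) :* (:1 :- s) := (a :- :1) :* (s :- :1)) refl (s ^ suc n) s)
        (*-nonNeg (≤⇒0≤- (subst (s ^ suc n ≤_) (1^n≡1 (suc n)) (^-mono-≤ (suc n) 0≤s s≤1))) (≤⇒0≤- s≤1))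

  -- s^i - 1 ≥ (i / k) (s^k - 1) for i ≥ k, cleared of denominators; the code has
  -- suc k for k and suc k + d for i.
  rational-bernoulli : ∀ {s} k d → 0# ≤ s → ι (suc k) + ι (suc k ℕ.+ d) * (s ^ suc k - 1#) ≤ ι
      (suc k) * s ^ (suc k ℕ.+ d)
  rational-bernoulli {s} k zero 0≤s = ≤-reflexive
      (trans (cong (λ i → ι (suc k) + ι i * (s ^ suc k - 1#)) (ℕₚ.+-identityʳ (suc k)))
    (trans (solve 2 (λ m a → m :+ m :* (a :- :1) := m :* a) refl (ι (suc k)) (s ^ suc k))
      (cong (λ i → ι (suc k) * s ^ i) (sym (ℕₚ.+-identityʳ (suc k))))))
  rational-bernoulli {s} k (suc d) 0≤s = subst (λ i → m + ι i * (a - 1#) ≤ m * s ^ i)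
      (sym (ℕₚ.+-suc (suc k) d))
    (*-cancelˡ-≤ (ι-pos (k ℕ.+ d)) (≤-by (0≤-+ (*-nonNeg (ι-nonNeg (suc k)) (step-convex (suc k ℕ.+ d) 0≤s))
        (*-nonNeg (ι-nonNeg (suc (suc k ℕ.+ d))) (≤⇒0≤- (rational-bernoulli k d 0≤s))))
            (eq m (ι (suc k ℕ.+ d)) a s (s ^ (suc k ℕ.+ d)))))
    where
    m a : ℝ
    m = ι (suc k)
    a = s ^ suc k
    eq : ∀ m i a s p → i * (m * (s * p)) ≡ i * (m + (1# + i) * (a - 1#)) +
      (m * (i * (s * p) + 1# - (1# + i) * p) + (1# + i) * (m * p - (m + i * (a - 1#))))
    eq m i a s p = solve 5 (λ m i b q p → i :* (m :* q) := i :* (m :+ (:1 :+ i) :* b) :+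
      (m :* (i :* q :+ :1 :- (:1 :+ i) :* p) :+ (:1 :+ i) :* (m :* p :- (m :+ i :* b)))) refl m i
          (a - 1#) (s * p) p

-- Bernoulli's inequality with a real exponent.

module RealBernoulli (R : CompleteOrderedField) where
  open OrderedField R
  open RealPowers R
  open PowerLaws R

  private
    -- The amount by which Bernoulli's inequality would fail if `p` is the power. Approximating `r`
    -- to within `1 / k′` bounds `k′` times this amount by the distance of `t` from 1, for every
    -- `k`.
    defect : ℝ → ℝ → ℝ → ℝ
    defect t r p = 1# + r * (t - 1#) - p

    module _ {t r : ℝ} (0<t : 0# < t) (1≤r : 1# ≤ r) (k : ℕ) where
      -- The root of `t` of order `suc k` turns `t` to the exponent `i / suc k` into the natural
      -- power `s ^ i`, where `rational-bernoulli` applies.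
      k′ s : ℝ
      k′ = ι (suc k)
      s = t ^ᴿ (k′ ⁻¹)

      0<s : 0# < s
      0<s = ^ᴿ-pos (k′ ⁻¹) 0<t

      sᵏ≡t : s ^ suc k ≡ t
      sᵏ≡t = trans (sym (^ᴿ-ι (suc k) 0<s)) (^ᴿ-inverse (<⇒≤ 0<t) (inv-pos (ι-pos k)) (inverseˡ (ι-pos k)))

      s^≡t^ : s ^ᴿ (k′ * r) ≡ t ^ᴿ r
      s^≡t^ = trans (^ᴿ-assoc (k′ ⁻¹) (k′ * r) 0<t) (cong (t ^ᴿ_)
        (trans (sym (*-assoc _ _ _)) (trans (cong (_* r) (inverseˡ (ι-pos k))) (*-identityˡ r))))

      k′≤k′r : k′ ≤ k′ * r
      k′≤k′r = subst (_≤ k′ * r) (*-identityʳ k′) (*-monoʳ-≤ (ι-nonNeg (suc k)) 1≤r)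

      rational : ∀ i → suc k ℕ.≤ i → k′ + ι i * (t - 1#) ≤ k′ * s ^ᴿ ι i
      rational i k≤i = subst (λ z → k′ + ι i * (t - 1#) ≤ k′ * z) (sym (^ᴿ-ι i 0<s))
        (subst (λ z → k′ + ι i * (z - 1#) ≤ k′ * s ^ i) sᵏ≡t
          (subst (λ j → k′ + ι j * (s ^ suc k - 1#) ≤ k′ * s ^ j) (ℕₚ.m+[n∸m]≡n k≤i)
            (rational-bernoulli k (i ℕ.∸ suc k) (<⇒≤ 0<s))))

      defect-≥1 : 1# ≤ t → ∀ i → ι i ≤ k′ * r → k′ * r < ι (suc i) → k′ * defect t r (t ^ᴿ r) ≤ t - 1#
      defect-≥1 1≤t i i≤ <i+1 = ≤-by (0≤-+ (*-nonNeg (≤⇒0≤- (<⇒≤ <i+1)) (≤⇒0≤- 1≤t))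
          (≤⇒0≤- (≤-trans (rational i k≤i) (*-monoʳ-≤ (ι-nonNeg (suc k))
            (subst (s ^ᴿ ι i ≤_) s^≡t^ (^ᴿ-mono-exp (1≤^ᴿ 1≤t (<⇒≤ (inv-pos (ι-pos k)))) i≤))))))
        (eq k′ r (t - 1#) (ι i) (t ^ᴿ r))
        where
        k≤i : suc k ℕ.≤ i
        k≤i = ℕ.s≤s⁻¹ (ι-cancel-< (≤-<-trans k′≤k′r <i+1))
        eq : ∀ m r u i p → u ≡ m * (1# + r * u - p) + ((1# + i - m * r) * u + (m * p - (m + i * u)))
        eq = solve 5 (λ m r u i p → u := m :* (:1 :+ r :* u :- p) :+
            ((:1 :+ i :- m :* r) :* u :+ (m :* p :- (m :+ i :* u)))) refl

      -- Powers of `s ≤ 1` fall as the exponent grows, so `k′ * r` is replaced by `suc i` from above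
      -- instead of `i` from below.
      defect-≤1 : t ≤ 1# → ∀ i → ι i ≤ k′ * r → k′ * r < ι (suc i) → k′ * defect t r (t ^ᴿ r) ≤ 1# - t
      defect-≤1 t≤1 i i≤ <i+1 = ≤-by (0≤-+ (*-nonNeg (≤⇒0≤- i≤) (≤⇒0≤- t≤1))
          (≤⇒0≤- (≤-trans (rational (suc i) k≤i) (*-monoʳ-≤ (ι-nonNeg (suc k))
            (subst (s ^ᴿ ι (suc i) ≤_) s^≡t^ (^ᴿ-antimono-exp 0<s
                (^ᴿ-≤1 (<⇒≤ 0<t) t≤1 (<⇒≤ (inv-pos (ι-pos k)))) (<⇒≤ <i+1)))))))
        (eq k′ r t (ι i) (t ^ᴿ r))
        where
        k≤i : suc k ℕ.≤ suc i
        k≤i = ℕₚ.<⇒≤ (ι-cancel-< (≤-<-trans k′≤k′r <i+1))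
        eq : ∀ m r t i p → 1# - t ≡ m * (1# + r * (t - 1#) - p) +
            ((m * r - i) * (1# - t) + (m * p - (m + (1# + i) * (t - 1#))))
        eq = solve 5 (λ m r t i p → :1 :- t := m :* (:1 :+ r :* (t :- :1) :- p) :+
            ((m :* r :- i) :* (:1 :- t) :+ (m :* p :- (m :+ (:1 :+ i) :* (t :- :1))))) refl

  -- All multiples of the defect have a common bound, so `bounded-multiples` makes it nonpositive.
  -- This tangent line at 1 is the pointwise input of `jensen`.
  ^ᴿ-bernoulli : ∀ {t r} → 0# ≤ t → 1# ≤ r → 1# + r * (t - 1#) ≤ t ^ᴿ r
  ^ᴿ-bernoulli {t} {r} 0≤t 1≤r = [ at-zero , positive-base ]′ (0≤⇒≡0⊎0< 0≤t)
    where
    0<r : 0# < r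
    0<r = <-≤-trans 0<1 1≤r
    at-zero : t ≡ 0# → 1# + r * (t - 1#) ≤ t ^ᴿ r
    at-zero refl = subst (1# + r * (0# - 1#) ≤_) (sym (0^ᴿ (<⇒≢ 0<r)))
      (≤-by (≤⇒0≤- 1≤r) (solve 1 (λ r → :0 := :1 :+ r :* (:0 :- :1) :+ (r :- :1)) refl r))
    positive-base : 0# < t → 1# + r * (t - 1#) ≤ t ^ᴿ r
    positive-base 0<t = ≤-by (neg≤0 (bounded (≤-total 1# t)))
      (solve 2 (λ x p → p := x :+ :- (x :- p)) refl (1# + r * (t - 1#)) (t ^ᴿ r))
      where
      multiples : ∀ {M} → 0# ≤ M → (∀ k i → ι i ≤ ι (suc k) * r → ι (suc k) * r < ι (suc i) →
        ι (suc k) * defect t r (t ^ᴿ r) ≤ M) → ∀ n → ι n * defect t r (t ^ᴿ r) ≤ M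
      multiples {M} 0≤M bound zero = subst (_≤ M) (sym (zeroˡ _)) 0≤M
      multiples 0≤M bound (suc k) = ≤-stable λ ≰M → floor (ι (suc k) * r)
        (*-nonNeg (ι-nonNeg (suc k)) (<⇒≤ 0<r)) λ (i , i≤ , <i+1) → ≰M (bound k i i≤ <i+1)
      bounded : 1# ≤ t ⊎ t ≤ 1# → defect t r (t ^ᴿ r) ≤ 0#
      bounded (inj₁ 1≤t) = bounded-multiples (multiples (≤⇒0≤- 1≤t) λ k → defect-≥1 0<t 1≤r k 1≤t)
      bounded (inj₂ t≤1) = bounded-multiples (multiples (≤⇒0≤- t≤1) λ k → defect-≤1 0<t 1≤r k t≤1)

-- Absolute values and one-sided limits.

module Limits (R : CompleteOrderedField) where
  open OrderedField R
  open PowerLaws R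

  ∣∣-cases : ∀ x → (0# ≤ x × ∣ x ∣ ≡ x) ⊎ (x ≤ 0# × ∣ x ∣ ≡ - x)
  ∣∣-cases x with 0# ≤? x
  ... | yes 0≤x = inj₁ (0≤x , refl)
  ... | no  0≰x = inj₂ (<⇒≤ (≰⇒> 0≰x) , refl)

  ∣∣-nonNeg : ∀ x → 0# ≤ ∣ x ∣
  ∣∣-nonNeg x = [ (λ (0≤x , e) → subst (0# ≤_) (sym e) 0≤x)
    , (λ (x≤0 , e) → subst (0# ≤_) (sym e) (neg≤0 x≤0)) ]′ (∣∣-cases x)

  x≤∣x∣ : ∀ x → x ≤ ∣ x ∣
  x≤∣x∣ x = [ (λ (0≤x , e) → ≤-reflexive (sym e)) , (λ (x≤0 , _) → ≤-trans x≤0 (∣∣-nonNeg x)) ]′ (∣∣-cases x)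

  -x≤∣x∣ : ∀ x → - x ≤ ∣ x ∣
  -x≤∣x∣ x = [ (λ (0≤x , _) → ≤-trans (subst (- x ≤_) -0#≈0# (neg-mono-≤ 0≤x)) (∣∣-nonNeg x))
    , (λ (x≤0 , e) → ≤-reflexive (sym e)) ]′ (∣∣-cases x)

  ∣∣-≤ : ∀ {x c} → x ≤ c → - x ≤ c → ∣ x ∣ ≤ c
  ∣∣-≤ {x} {c} x≤c -x≤c = [ (λ (_ , e) → subst (_≤ c) (sym e) x≤c) ,
      (λ (_ , e) → subst (_≤ c) (sym e) -x≤c) ]′ (∣∣-cases x)

  ∣∣-nonNeg-≡ : ∀ {x} → 0# ≤ x → ∣ x ∣ ≡ x
  ∣∣-nonNeg-≡ {x} 0≤x = ≤-antisym (∣∣-≤ ≤-refl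
      (≤-trans (subst (- x ≤_) -0#≈0# (neg-mono-≤ 0≤x)) 0≤x)) (x≤∣x∣ x)

  ∣-x∣≡∣x∣ : ∀ x → ∣ - x ∣ ≡ ∣ x ∣
  ∣-x∣≡∣x∣ x = ≤-antisym (∣∣-≤ (-x≤∣x∣ x) (subst (_≤ ∣ x ∣) (sym (-‿involutive x)) (x≤∣x∣ x)))
    (∣∣-≤ (subst (_≤ ∣ - x ∣) (-‿involutive x) (-x≤∣x∣ (- x))) (x≤∣x∣ (- x)))

  ∣∣-triangle : ∀ x y → ∣ x + y ∣ ≤ ∣ x ∣ + ∣ y ∣
  ∣∣-triangle x y = ∣∣-≤ (+-mono-≤ (x≤∣x∣ x) (x≤∣x∣ y))
    (subst (_≤ ∣ x ∣ + ∣ y ∣) (-‿+-comm x y) (+-mono-≤ (-x≤∣x∣ x) (-x≤∣x∣ y)))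

  ∣∣-*-≤ : ∀ {x y c d} → ∣ x ∣ ≤ c → ∣ y ∣ ≤ d → ∣ x * y ∣ ≤ c * d
  ∣∣-*-≤ {x} {y} {c} {d} x≤c y≤d = ≤-trans (∣∣-≤ (product-≤ x y)
      (subst (_≤ ∣ x ∣ * ∣ y ∣) (sym (-‿distribˡ-* x y))
      (subst (λ z → - x * y ≤ z * ∣ y ∣) (∣-x∣≡∣x∣ x) (product-≤ (- x) y))))
          (*-mono-≤ (∣∣-nonNeg x) (∣∣-nonNeg y) x≤c y≤d)
    where
    product-≤ : ∀ x y → x * y ≤ ∣ x ∣ * ∣ y ∣
    product-≤ x y = [ (λ (0≤x , e) → subst (λ z → x * y ≤ z * ∣ y ∣) (sym e) (*-monoʳ-≤ 0≤x (x≤∣x∣ y)))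
      , (λ (x≤0 , e) → subst₂ _≤_ (solve 2 (λ x y → (:- x) :* (:- y) := x :* y) refl x y)
          (cong (_* ∣ y ∣) (sym e))
          (*-monoʳ-≤ (neg≤0 x≤0) (-x≤∣x∣ y))) ]′ (∣∣-cases x)

  ∣∣-pos : ∀ {x} → x ≢ 0# → 0# < ∣ x ∣
  ∣∣-pos {x} x≢0 = ∣∣-nonNeg x , λ 0≡∣x∣ → x≢0 (≤-antisym (subst (x ≤_) (sym 0≡∣x∣) (x≤∣x∣ x))
    (subst₂ _≤_ -0#≈0# (-‿involutive x) (neg-mono-≤ (subst (- x ≤_) (sym 0≡∣x∣) (-x≤∣x∣ x)))))

  ∣x∣∣x∣≡xx : ∀ x → ∣ x ∣ * ∣ x ∣ ≡ x * x
  ∣x∣∣x∣≡xx x = [ (λ (_ , e) → cong₂ _*_ e e)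
    , (λ (_ , e) → trans (cong₂ _*_ e e) (solve 1 (λ x → (:- x) :* (:- x) := x :* x) refl x)) ]′ (∣∣-cases x)

  -- Eventually as h → 0⁺.
  Eventually : (ℝ → Set) → Set
  Eventually Q = ∃[ δ ] (0# < δ × (∀ h → 0# < h → h ≤ δ → Q h))

  ev-map : ∀ {Q Q′ : ℝ → Set} → (∀ {h} → Q h → Q′ h) → Eventually Q → Eventually Q′
  ev-map f (δ , 0<δ , q) = δ , 0<δ , λ h 0<h h≤δ → f (q h 0<h h≤δ)

  ev-all : ∀ {Q : ℝ → Set} → (∀ h → Q h) → Eventually Q
  ev-all q = 1# , 0<1 , λ h _ _ → q h

  ev-× : ∀ {Q Q′ : ℝ → Set} → Eventually Q → Eventually Q′ → Eventually (λ h → Q h × Q′ h)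
  ev-× (δ , 0<δ , q) (δ′ , 0<δ′ , q′) with ≤-total δ δ′
  ... | inj₁ δ≤δ′ = δ , 0<δ , λ h 0<h h≤ → q h 0<h h≤ , q′ h 0<h (≤-trans h≤ δ≤δ′)
  ... | inj₂ δ′≤δ = δ′ , 0<δ′ , λ h 0<h h≤ → q h 0<h (≤-trans h≤ δ′≤δ) , q′ h 0<h h≤

  ev-∀ : ∀ {n} {Q : Fin n → ℝ → Set} → (∀ i → Eventually (Q i)) → Eventually (λ h → ∀ i → Q i h)
  ev-∀ {zero}  q = ev-all λ h ()
  ev-∀ {suc n} q = ev-map (λ (q₀ , qₛ) → λ { zero → q₀ ; (suc i) → qₛ i }) (ev-× (q zero) (ev-∀ (q ∘ suc)))

  ev-witness : ∀ {Q : ℝ → Set} → Eventually Q → ∃[ h ] Q h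
  ev-witness (δ , 0<δ , q) = δ , q δ 0<δ ≤-refl

  between : ∀ {x y} → x < y → ∃[ z ] (x < z × z < y)
  between {x} {y} x<y = m
    , ≰⇒> (λ m≤x → <⇒≱ x<y (+-cancelʳ-≤ x (subst₂ _≤_ (trans double (+-comm x y)) (twice x)
        (*-monoˡ-≤ (<⇒≤ 0<2) m≤x))))
    , ≰⇒> (λ y≤m → <⇒≱ x<y (+-cancelʳ-≤ y (subst₂ _≤_ (twice y) double (*-monoˡ-≤ (<⇒≤ 0<2) y≤m))))
    where
    m : ℝ
    m = (x + y) / 2#
    double : m * 2# ≡ x + y
    double = /-cancel 0<2
    twice : ∀ z → z * 2# ≡ z + z
    twice = solve 1 (λ z → z :* (:1 :+ :1) := z :+ z) refl

  ev-≢ : ∀ c → Eventually (_≢ c)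
  ev-≢ c with ≤-<-dec c 0#
  ... | inj₁ c≤0 = 1# , 0<1 , λ h 0<h _ → <⇒≢ (≤-<-trans c≤0 0<h)
  ... | inj₂ 0<c = proj₁ (between 0<c) , proj₁ (proj₂ (between 0<c)) , λ h _ h≤ h≡c →
    <⇒≱ (≤-<-trans h≤ (proj₂ (proj₂ (between 0<c)))) (≤-reflexive (sym h≡c))

  Null : (ℝ → ℝ) → Set
  Null F = ∀ ε → 0# < ε → Eventually (λ h → ∣ F h ∣ ≤ ε)

  null-ext : ∀ {F G} → (∀ h → G h ≡ F h) → Null F → Null G
  null-ext G≡F f ε 0<ε = ev-map (λ {h} → subst (λ z → ∣ z ∣ ≤ ε) (sym (G≡F h))) (f ε 0<ε)

  null-0 : Null (λ _ → 0#)
  null-0 ε 0<ε = ev-all λ _ → subst (_≤ ε) (sym (∣∣-nonNeg-≡ ≤-refl)) (<⇒≤ 0<ε)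

  null-+ : ∀ {F G} → Null F → Null G → Null (λ h → F h + G h)
  null-+ {F} {G} f g ε 0<ε = ev-map (λ {h} (p , q) → ≤-trans (∣∣-triangle (F h) (G h))
      (subst (∣ F h ∣ + ∣ G h ∣ ≤_) halves (+-mono-≤ p q)))
          (ev-× (f (ε / 2#) (/-pos 0<ε 0<2)) (g (ε / 2#) (/-pos 0<ε 0<2)))
    where
    halves : ε / 2# + ε / 2# ≡ ε
    halves = trans (solve 1 (λ a → a :+ a := a :* (:1 :+ :1)) refl (ε / 2#)) (/-cancel 0<2)

  null-* : ∀ {F G} → Null F → Null G → Null (λ h → F h * G h)
  null-* {F} {G} f g ε 0<ε = ev-map (λ {h} (p , q) → subst (∣ F h * G h ∣ ≤_) (*-identityˡ ε) (∣∣-*-≤ p q))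
    (ev-× (f 1# 0<1) (g ε 0<ε))

  null-scale : ∀ {F} c → Null F → Null (λ h → c * F h)
  null-scale {F} c f ε 0<ε = ev-map (λ {h} p → subst (∣ c * F h ∣ ≤_)
      (trans (*-comm C (ε / C)) (/-cancel 0<C))
      (∣∣-*-≤ (x≤x+1 ∣ c ∣) p)) (f (ε / C) (/-pos 0<ε 0<C))
    where
    C : ℝ
    C = ∣ c ∣ + 1#
    0<C : 0# < C
    0<C = 0<-+ʳ (∣∣-nonNeg c) 0<1

  infix 4 _⟶_
  _⟶_ : (ℝ → ℝ) → ℝ → Set
  F ⟶ L = Null (λ h → F h - L)

  lim-const : ∀ c → (λ _ → c) ⟶ c
  lim-const c = null-ext (λ _ → -‿inverseʳ c) null-0

  lim-h : (λ h → h) ⟶ 0#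
  lim-h ε 0<ε = ε , 0<ε , λ h 0<h h≤ε → subst (_≤ ε)
      (sym (trans (cong ∣_∣ (trans (cong (h +_) -0#≈0#) (+-identityʳ h)))
    (∣∣-nonNeg-≡ (<⇒≤ 0<h)))) h≤ε

  lim-+ : ∀ {F G L M} → F ⟶ L → G ⟶ M → (λ h → F h + G h) ⟶ L + M
  lim-+ {F} {G} {L} {M} f g = null-ext (λ h → solve 4
      (λ a b l m → a :+ b :- (l :+ m) := (a :- l) :+ (b :- m)) refl (F h) (G h) L M)
    (null-+ f g)

  -- Expanding around the two limits leaves only null terms, so no separate bound on `F` or `G` is
  -- required.
  lim-* : ∀ {F G L M} → F ⟶ L → G ⟶ M → (λ h → F h * G h) ⟶ L * M
  lim-* {F} {G} {L} {M} f g = null-ext (λ h → solve 4 (λ a b l m → a :* b :- l :* m :=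
      (a :- l) :* (b :- m) :+ (l :* (b :- m) :+ m :* (a :- l))) refl (F h) (G h) L M)
    (null-+ (null-* f g) (null-+ (null-scale L g) (null-scale M f)))

  lim-neg : ∀ {F L} → F ⟶ L → (λ h → - F h) ⟶ - L
  lim-neg {F} {L} f = null-ext (λ h → solve 2 (λ a l → :- a :- :- l := (:- :1) :* (a :- l)) refl
      (F h) L) (null-scale (- 1#) f)

  lim-- : ∀ {F G L M} → F ⟶ L → G ⟶ M → (λ h → F h - G h) ⟶ L - M
  lim-- f g = lim-+ f (lim-neg g)

  lim-∣∣ : ∀ {F L} → F ⟶ L → (λ h → ∣ F h ∣) ⟶ ∣ L ∣
  lim-∣∣ {F} {L} f ε 0<ε = ev-map (λ {h} p → ≤-trans (∣∣-≤ (difference (F h) L)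
      (subst₂ _≤_ (solve 2 (λ a b → b :- a := :- (a :- b)) refl (∣ F h ∣) (∣ L ∣))
        (trans (sym (∣-x∣≡∣x∣ (L - F h))) (cong ∣_∣
            (solve 2 (λ a b → :- (b :- a) := a :- b) refl (F h) L))) (difference L (F h)))) p)
                (f ε 0<ε)
    where
    difference : ∀ a b → ∣ a ∣ - ∣ b ∣ ≤ ∣ a - b ∣
    difference a b = +-cancelʳ-≤ ∣ b ∣ (subst₂ _≤_
        (trans (cong ∣_∣ (eq a b)) (sym (eq ∣ a ∣ ∣ b ∣))) refl (∣∣-triangle (a - b) b))
      where
      eq : ∀ a b → (a - b) + b ≡ a
      eq = solve 2 (λ a b → (a :- b) :+ b := a) refl

  lim-sum : ∀ {n} {F : Fin n → ℝ → ℝ} {L : Fin n → ℝ} → (∀ i → F i ⟶ L i) → (λ h → sum (λ i → F i h)) ⟶ sum L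
  lim-sum {zero}  f = lim-const 0#
  lim-sum {suc n} f = lim-+ (f zero) (lim-sum (f ∘ suc))

  lim-if : ∀ (b : Bool) {F G L M} → F ⟶ L → G ⟶ M → (λ h → if b then F h else G h) ⟶ (if b then L else M)
  lim-if true  f g = f
  lim-if false f g = g

  lim-ev-≤ : ∀ {F L v} → F ⟶ L → L < v → Eventually (λ h → F h ≤ v)
  lim-ev-≤ {F} {L} {v} f L<v = ev-map (λ {h} p → +-cancelʳ-≤ (- L) (≤-trans (x≤∣x∣ (F h - L)) p))
      (f (v - L) (x<y⇒0<y-x L<v))
    where
    x<y⇒0<y-x : ∀ {x y} → x < y → 0# < y - x
    x<y⇒0<y-x {x} {y} x<y = ≰⇒> λ le → <⇒≱ x<y
        (≤-by (neg≤0 le) (solve 2 (λ x y → x := y :+ :- (y :- x)) refl x y))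

  lim-ev-≥ : ∀ {F L v} → F ⟶ L → v < L → Eventually (λ h → v ≤ F h)
  lim-ev-≥ {F} {L} {v} f v<L = ev-map (λ {h} p → subst₂ _≤_ (-‿involutive v) (-‿involutive (F h))
      (neg-mono-≤ p))
    (lim-ev-≤ (lim-neg f) (neg-mono-< v<L))
    where
    neg-mono-< : ∀ {x y} → x < y → - y < - x
    neg-mono-< {x} {y} x<y = ≰⇒> λ le → <⇒≱ x<y (subst₂ _≤_ (-‿involutive y) (-‿involutive x) (neg-mono-≤ le))

  lim-from-order : ∀ {F L} → (∀ v → L < v → Eventually (λ h → F h ≤ v)) →
      (∀ v → v < L → Eventually (λ h → v ≤ F h)) → F ⟶ L
  lim-from-order {F} {L} above below ε 0<ε = ev-map (λ {h} (p , q) → ∣∣-≤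
      (+-cancelʳ-≤ L (subst₂ _≤_ (solve 2 (λ a l → a := (a :- l) :+ l) refl (F h) L) (+-comm L ε) p))
      (+-cancelʳ-≤ (F h - ε) (subst₂ _≤_ (solve 3 (λ a l e → l :- e := :- (a :- l) :+ (a :- e)) refl
          (F h) L ε)
        (solve 2 (λ a e → a := e :+ (a :- e)) refl (F h) ε) q)))
    (ev-× (above (L + ε) (≰⇒> λ le → <⇒≱ 0<ε (≤-by (≤⇒0≤- le)
        (solve 2 (λ l e → :0 := e :+ (l :- (l :+ e))) refl L ε))))
          (below (L - ε) (≰⇒> λ le → <⇒≱ 0<ε (≤-by (≤⇒0≤- le)
              (solve 2 (λ l e → :0 := e :+ ((l :- e) :- l)) refl L ε)))))

  lim-nonNeg : ∀ {F L} → F ⟶ L → Eventually (λ h → 0# ≤ F h) → 0# ≤ L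
  lim-nonNeg {F} {L} f 0≤F = [ (λ 0≤L → 0≤L) , (λ L<0 → impossible (between L<0)) ]′ (≤-<-dec 0# L)
    where
    impossible : ∃[ v ] (L < v × v < 0#) → 0# ≤ L
    impossible (v , L<v , v<0) = contradiction (ev-witness (ev-× 0≤F (lim-ev-≤ f L<v)))
      λ (h , 0≤Fh , Fh≤v) → <⇒≱ v<0 (≤-trans 0≤Fh Fh≤v)

  lim-≤ : ∀ {F G L M} → F ⟶ L → G ⟶ M → Eventually (λ h → F h ≤ G h) → L ≤ M
  lim-≤ f g F≤G = 0≤-⇒≤ (lim-nonNeg (lim-- g f) (ev-map ≤⇒0≤- F≤G))

  lim-^ᴿ : ∀ {F u a} → 0# ≤ a → 0# ≤ u → (∀ h → 0# ≤ F h) → F ⟶ u → (λ h → F h ^ᴿ a) ⟶ u ^ᴿ a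
  lim-^ᴿ {F} {u} {a} 0≤a 0≤u 0≤F f = [ at-zero , positive-exponent ]′ (0≤⇒≡0⊎0< 0≤a)
    where
    -- This case carries p = 2, where the weight has exponent 0: the power is constantly 1, at base
    -- 0 too.
    at-zero : a ≡ 0# → (λ h → F h ^ᴿ a) ⟶ u ^ᴿ a
    at-zero refl = null-ext (λ h → trans (cong₂ _-_ (^ᴿ0 (0≤F h)) (^ᴿ0 0≤u)) (-‿inverseʳ 1#)) null-0
    -- x ↦ x ^ᴿ a is a monotone bijection of [0 , ∞), hence continuous.
    positive-exponent : 0# < a → (λ h → F h ^ᴿ a) ⟶ u ^ᴿ a
    positive-exponent 0<a = lim-from-order above below
      where
      root-power : ∀ {v} → 0# ≤ v → (v ^ᴿ (a ⁻¹)) ^ᴿ a ≡ v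
      root-power 0≤v = ^ᴿ-inverse 0≤v (inv-pos 0<a) (inverseˡ 0<a)
      above : ∀ v → u ^ᴿ a < v → Eventually (λ h → F h ^ᴿ a ≤ v)
      above v uᵃ<v = ev-map (λ {h} p → subst (F h ^ᴿ a ≤_) (root-power 0≤v) (^ᴿ-mono-≤ 0≤a (0≤F h) p))
        (lim-ev-≤ f (≰⇒> λ le → <⇒≱ uᵃ<v (subst (_≤ u ^ᴿ a) (root-power 0≤v)
            (^ᴿ-mono-≤ 0≤a (^ᴿ-nonNeg (a ⁻¹) 0≤v) le))))
        where
        0≤v : 0# ≤ v
        0≤v = ≤-trans (^ᴿ-nonNeg a 0≤u) (<⇒≤ uᵃ<v)
      below : ∀ v → v < u ^ᴿ a → Eventually (λ h → v ≤ F h ^ᴿ a)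
      -- The root of `v` is taken for `v ≥ 0`; for `v ≤ 0` nonnegativity of the power is enough.
      below v v<uᵃ = [ (λ v≤0 → ev-all λ h → ≤-trans v≤0 (^ᴿ-nonNeg a (0≤F h))) ,
          (λ 0<v → below-pos (<⇒≤ 0<v)) ]′ (≤-<-dec v 0#)
        where
        below-pos : 0# ≤ v → Eventually (λ h → v ≤ F h ^ᴿ a)
        below-pos 0≤v = ev-map (λ {h} p → subst (_≤ F h ^ᴿ a) (root-power 0≤v)
            (^ᴿ-mono-≤ 0≤a (^ᴿ-nonNeg (a ⁻¹) 0≤v) p))
          (lim-ev-≥ f (≰⇒> λ le → <⇒≱ v<uᵃ (subst (u ^ᴿ a ≤_) (root-power 0≤v) (^ᴿ-mono-≤ 0≤a 0≤u le))))

-- Edge sums and integration on a signed graph.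

module GraphCalculus (R : CompleteOrderedField) {n : ℕ} (G : SignedGraph n) where
  open OrderedField R
  open PowerLaws R
  open Limits R
  open SignedGraph G
  open SignedLaplacian R G
  open SemiringSum semiring using (sum-cong-≗; ∑-distrib-+; *-distribˡ-sum; ∑-comm; sum-replicate-zero)

  sum-mono : ∀ {m} {g h : Fin m → ℝ} → (∀ i → g i ≤ h i) → sum g ≤ sum h
  sum-mono {zero}  le = ≤-refl
  sum-mono {suc m} le = +-mono-≤ (le zero) (sum-mono (le ∘ suc))

  sum-nonNeg : ∀ {m} {g : Fin m → ℝ} → (∀ i → 0# ≤ g i) → 0# ≤ sum g
  sum-nonNeg {zero}  0≤g = ≤-refl
  sum-nonNeg {suc m} 0≤g = 0≤-+ (0≤g zero) (sum-nonNeg (0≤g ∘ suc))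

  term≤sum : ∀ {m} {g : Fin m → ℝ} → (∀ i → 0# ≤ g i) → ∀ i → g i ≤ sum g
  term≤sum {suc m} {g} 0≤g zero    = ≤-by (sum-nonNeg (0≤g ∘ suc)) refl
  term≤sum {suc m} {g} 0≤g (suc i) = ≤-trans (term≤sum (0≤g ∘ suc) i) (≤-by (0≤g zero) (+-comm _ _))

  sum-zero : ∀ {m} {g : Fin m → ℝ} → (∀ i → g i ≡ 0#) → sum g ≡ 0#
  sum-zero {m} g≡0 = trans (sum-cong-≗ g≡0) (sum-replicate-zero m)

  sum-neg : ∀ {m} (g : Fin m → ℝ) → sum (λ i → - g i) ≡ - sum g
  sum-neg g = trans (sum-cong-≗ λ i → solve 1 (λ a → :- a := (:- :1) :* a) refl (g i))
    (trans (sym (*-distribˡ-sum (- 1#) g)) (solve 1 (λ a → (:- :1) :* a := :- a) refl (sum g)))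

  restrict : V → V → ℝ → ℝ
  restrict x y a = if does (x ~? y) then a else 0#

  restrict-on : ∀ {x y} a → x ~ y → restrict x y a ≡ a
  restrict-on {x} {y} a x~y with x ~? y
  ... | yes _   = refl
  ... | no  x≁y = contradiction x~y x≁y

  restrict-off : ∀ {x y} a → ¬ x ~ y → restrict x y a ≡ 0#
  restrict-off {x} {y} a x≁y with x ~? y
  ... | yes x~y = contradiction x~y x≁y
  ... | no  _   = refl

  restrict-elim : ∀ {x y a} (P : ℝ → Set) → (x ~ y → P a) → (¬ x ~ y → P 0#) → P (restrict x y a)
  restrict-elim {x} {y} P on off with x ~? y
  ... | yes x~y = on x~y
  ... | no  x≁y = off x≁y

  restrict-cong : ∀ {x y a b} → (x ~ y → a ≡ b) → restrict x y a ≡ restrict x y b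
  restrict-cong {x} {y} eq with x ~? y
  ... | yes x~y = eq x~y
  ... | no  _   = refl

  restrict-sym : ∀ x y a → restrict x y a ≡ restrict y x a
  restrict-sym x y a = restrict-elim (λ z → z ≡ restrict y x a) (λ x~y → sym (restrict-on a (~-sym x~y)))
    (λ x≁y → sym (restrict-off a (x≁y ∘ ~-sym)))

  nbrs-cong : ∀ x {g h} → (∀ {y} → x ~ y → g y ≡ h y) → sumNbrs x g ≡ sumNbrs x h
  nbrs-cong x {g} {h} eq = sum-cong-≗ λ y → restrict-cong {x} {y} {g y} {h y} eq

  nbrs-nonNeg : ∀ x {g} → (∀ y → 0# ≤ g y) → 0# ≤ sumNbrs x g
  nbrs-nonNeg x 0≤g = sum-nonNeg λ y → restrict-elim (0# ≤_) (λ _ → 0≤g y) (λ _ → ≤-refl)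

  nbrs-+ : ∀ x g h → sumNbrs x (λ y → g y + h y) ≡ sumNbrs x g + sumNbrs x h
  nbrs-+ x g h = trans (sum-cong-≗ λ y → split y)
      (∑-distrib-+ (λ y → restrict x y (g y)) (λ y → restrict x y (h y)))
    where
    split : ∀ y → restrict x y (g y + h y) ≡ restrict x y (g y) + restrict x y (h y)
    split y with x ~? y
    ... | yes _ = refl
    ... | no  _ = sym (+-identityˡ 0#)

  nbrs-scale : ∀ x c g → sumNbrs x (λ y → c * g y) ≡ c * sumNbrs x g
  nbrs-scale x c g = trans (sum-cong-≗ λ y → pull y) (sym (*-distribˡ-sum c (λ y → restrict x y (g y))))
    where
    pull : ∀ y → restrict x y (c * g y) ≡ c * restrict x y (g y)
    pull y with x ~? y
    ... | yes _ = refl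
    ... | no  _ = sym (zeroʳ c)

  nbrs-empty : ∀ x g → (∀ y → ¬ x ~ y) → sumNbrs x g ≡ 0#
  nbrs-empty x g x≁ = sum-zero λ y → restrict-off (g y) (x≁ y)

  lim-nbrs : ∀ x {F : V → ℝ → ℝ} {L : V → ℝ} → (∀ y → F y ⟶ L y) →
      (λ h → sumNbrs x (λ y → F y h)) ⟶ sumNbrs x L
  lim-nbrs x f = lim-sum λ y → lim-if (does (x ~? y)) (f y) (lim-const 0#)

  -- Adjacency is symmetric, so every edge is counted once from either end. This is the source of
  -- all integrations by parts.
  edge-sum-swap : ∀ (a : V → V → ℝ) → sum (λ x → sumNbrs x (λ y → a x y)) ≡ sum
      (λ x → sumNbrs x (λ y → a y x))
  edge-sum-swap a = trans (∑-comm (λ x y → restrict x y (a x y)))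
    (sum-cong-≗ λ y → sum-cong-≗ λ x → restrict-sym x y (a x y))

  isolated-or-1≤deg : ∀ x → (∀ y → ¬ x ~ y) ⊎ 1# ≤ deg x
  isolated-or-1≤deg x with Finₚ.any? (x ~?_)
  ... | no  x≁        = inj₁ λ y x~y → x≁ (y , x~y)
  ... | yes (y , x~y) = inj₂ (subst (_≤ deg x) (restrict-on 1# x~y)
    (term≤sum {g = λ y → restrict x y 1#} (λ y → restrict-elim (0# ≤_) (λ _ → 0≤1) (λ _ → ≤-refl)) y))

  deg-nonNeg : ∀ x → 0# ≤ deg x
  deg-nonNeg x = nbrs-nonNeg x λ _ → 0≤1

  -- An isolated vertex has deg x = 0, and 1 / 0 is unspecified; but then the
  -- sum over the neighbours vanishes too.
  deg-cancel : ∀ x g → deg x * (1# / deg x * sumNbrs x g) ≡ sumNbrs x g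
  deg-cancel x g = [ isolated , (λ 1≤d → connected (<-≤-trans 0<1 1≤d)) ]′ (isolated-or-1≤deg x)
    where
    isolated : (∀ y → ¬ x ~ y) → deg x * (1# / deg x * sumNbrs x g) ≡ sumNbrs x g
    isolated x≁ = trans (cong (deg x *_) (trans (cong (1# / deg x *_) (nbrs-empty x g x≁)) (zeroʳ _)))
      (trans (zeroʳ _) (sym (nbrs-empty x g x≁)))
    connected : 0# < deg x → deg x * (1# / deg x * sumNbrs x g) ≡ sumNbrs x g
    connected 0<d = by-unit (inverse 0<d) (_* sumNbrs x g)
      (solve 3 (λ d i s → d :* (:1 :* i :* s) := d :* i :* s) refl (deg x) (deg x ⁻¹) (sumNbrs x g))
          (*-identityˡ _)

  2deg-cancel : ∀ x g → 2# * (deg x * (1# / (2# * deg x) * sumNbrs x g)) ≡ sumNbrs x g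
  2deg-cancel x g = [ isolated , (λ 1≤d → connected (<-≤-trans 0<1 1≤d)) ]′ (isolated-or-1≤deg x)
    where
    isolated : (∀ y → ¬ x ~ y) → 2# * (deg x * (1# / (2# * deg x) * sumNbrs x g)) ≡ sumNbrs x g
    isolated x≁ = trans (cong (λ z → 2# * (deg x * (1# / (2# * deg x) * z))) (nbrs-empty x g x≁))
      (trans (trans (sym (*-assoc _ _ _)) (trans (sym (*-assoc _ _ _)) (zeroʳ _))) (sym (nbrs-empty x g x≁)))
    connected : 0# < deg x → 2# * (deg x * (1# / (2# * deg x) * sumNbrs x g)) ≡ sumNbrs x g
    connected 0<d = by-unit (inverse (0<-* 0<2 0<d)) (_* sumNbrs x g)
      (solve 4 (λ t d i s → t :* (d :* (:1 :* i :* s)) := t :* d :* i :* s) refl 2# (deg x)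
          ((2# * deg x) ⁻¹) (sumNbrs x g)) (*-identityˡ _)

  sign-square : ∀ x y → sign x y * sign x y ≡ 1#
  sign-square x y with σ x y
  ... | Sign.+ = *-identityˡ 1#
  ... | Sign.- = solve 0 ((:- :1) :* (:- :1) := :1) refl

  sign-sym : ∀ {x y} → x ~ y → sign x y ≡ sign y x
  sign-sym {x} {y} x~y with σ x y | σ y x | σ-sym x~y
  ... | Sign.+ | Sign.+ | _ = refl
  ... | Sign.- | Sign.- | _ = refl

  ∣sign*∣ : ∀ x y t → ∣ sign x y * t ∣ ≡ ∣ t ∣
  ∣sign*∣ x y t with σ x y
  ... | Sign.+ = cong ∣_∣ (*-identityˡ t)
  ... | Sign.- = trans (cong ∣_∣ (solve 1 (λ t → (:- :1) :* t := :- t) refl t)) (∣-x∣≡∣x∣ t)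

  -- Factor out `sign x y`, whose square is 1. Consequently the weight of an edge does not depend on
  -- its orientation.
  ∂-flip : ∀ f {x y} → x ~ y → ∂ f y x ≡ - (sign x y * ∂ f x y)
  ∂-flip f {x} {y} x~y = trans (cong (λ s → s * f x - f y) (sym (sign-sym x~y)))
    (sym (by-unit (sign-square x y) (λ z → s * f x - z * f y)
      (solve 3 (λ s a b → :- (s :* (s :* b :- a)) := s :* a :- s :* s :* b) refl s (f x) (f y))
      (cong (λ z → s * f x - z) (*-identityˡ (f y)))))
    where
    s : ℝ
    s = sign x y

  ∣∂∣-sym : ∀ f {x y} → x ~ y → ∣ ∂ f y x ∣ ≡ ∣ ∂ f x y ∣
  ∣∂∣-sym f {x} {y} x~y = trans (cong ∣_∣ (∂-flip f x~y)) (trans (∣-x∣≡∣x∣ _) (∣sign*∣ x y (∂ f x y)))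

  ∫ : (V → ℝ) → ℝ
  ∫ g = sum λ x → deg x * g x

  ∫-cong : ∀ {g h} → (∀ x → g x ≡ h x) → ∫ g ≡ ∫ h
  ∫-cong eq = sum-cong-≗ λ x → cong (deg x *_) (eq x)

  ∫-mono : ∀ {g h} → (∀ x → g x ≤ h x) → ∫ g ≤ ∫ h
  ∫-mono le = sum-mono λ x → *-monoʳ-≤ (deg-nonNeg x) (le x)

  ∫-+ : ∀ g h → ∫ (λ x → g x + h x) ≡ ∫ g + ∫ h
  ∫-+ g h = trans (sum-cong-≗ λ x → distribˡ (deg x) (g x) (h x))
      (∑-distrib-+ (λ x → deg x * g x) (λ x → deg x * h x))

  ∫-scale : ∀ c g → ∫ (λ x → c * g x) ≡ c * ∫ g
  ∫-scale c g = trans (sum-cong-≗ λ x → solve 3 (λ d c g → d :* (c :* g) := c :* (d :* g)) refl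
      (deg x) c (g x))
    (sym (*-distribˡ-sum c (λ x → deg x * g x)))

  ∫-1 : ∫ (λ _ → 1#) ≡ vol
  ∫-1 = sum-cong-≗ λ x → *-identityʳ (deg x)

  module _ (p : ℝ) where
    -- `∂ g x y` splits into a term at `y` and a term at `x`; reversing the edges turns the first
    -- sum into the second by `∂-flip`. The two equal halves cancel the 1/2 in `Γ`.
    green : ∀ f g → ∫ (Γ p f g) ≡ - ∫ (λ x → g x * Δ p f x)
    green f g = *-cancelˡ-≡ 0<2 (begin
      2# * ∫ (Γ p f g)                                ≡⟨ *-distribˡ-sum 2# (λ x → deg x * Γ p f g x) ⟩
      sum (λ x → 2# * (deg x * Γ p f g x))
          ≡⟨ sum-cong-≗ (λ x → 2deg-cancel x (λ y → φ p (∂ f x y) * ∂ g x y)) ⟩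
      sum (λ x → sumNbrs x (λ y → φ p (∂ f x y) * ∂ g x y))
        ≡⟨ sum-cong-≗ (λ x → trans (nbrs-cong x
            (λ {y} _ → solve 4 (λ q s a b → q :* (s :* a :- b) := q :* (s :* a) :+ (:- b) :* q) refl
                (φ p (∂ f x y)) (sign x y) (g y) (g x)))
                    (nbrs-+ x (λ y → a x y) (λ y → - g x * φ p (∂ f x y)))) ⟩
      sum (λ x → sumNbrs x (a x) + sumNbrs x (λ y → - g x * φ p (∂ f x y)))
        ≡⟨ ∑-distrib-+ (λ x → sumNbrs x (a x)) (λ x → sumNbrs x (λ y → - g x * φ p (∂ f x y))) ⟩
      sum (λ x → sumNbrs x (a x)) + half
          ≡⟨ cong (_+ half) (trans (edge-sum-swap a) (sum-cong-≗ λ x → nbrs-cong x flip)) ⟩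
      half + half                                     ≡⟨ solve 1 (λ a → a :+ a := (:1 :+ :1) :* a) refl half ⟩
      2# * half                                       ≡⟨ cong (2# *_) half≡ ⟩
      2# * - ∫ (λ x → g x * Δ p f x)                   ∎)
      where
      open ≡-Reasoning
      a : V → V → ℝ
      a x y = φ p (∂ f x y) * (sign x y * g y)
      half : ℝ
      half = sum (λ x → sumNbrs x (λ y → - g x * φ p (∂ f x y)))
      flip : ∀ {x y} → x ~ y → a y x ≡ - g x * φ p (∂ f x y)
      flip {x} {y} x~y = begin
        ∣ ∂ f y x ∣ ^ᴿ (p - 2#) * ∂ f y x * (sign y x * g x)
          ≡⟨ cong₂ _*_ (cong₂ (λ u v → u ^ᴿ (p - 2#) * v) (∣∂∣-sym f x~y) (∂-flip f x~y))
              (cong (_* g x) (sym (sign-sym x~y))) ⟩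
        w * - (s * d) * (s * g x)   ≡⟨ solve 4
            (λ w s d g → w :* :- (s :* d) :* (s :* g) := s :* s :* (:- g :* (w :* d))) refl w s d
                (g x) ⟩
        s * s * (- g x * (w * d))   ≡⟨ cong (_* (- g x * (w * d))) (sign-square x y) ⟩
        1# * (- g x * (w * d))      ≡⟨ *-identityˡ _ ⟩
        - g x * (w * d)             ∎
        where
        w s d : ℝ
        w = ∣ ∂ f x y ∣ ^ᴿ (p - 2#)
        s = sign x y
        d = ∂ f x y
      half≡ : half ≡ - ∫ (λ x → g x * Δ p f x)
      half≡ = trans (sum-cong-≗ λ x → begin
          sumNbrs x (λ y → - g x * φ p (∂ f x y))   ≡⟨ nbrs-scale x (- g x) (λ y → φ p (∂ f x y)) ⟩
          - g x * sumNbrs x (λ y → φ p (∂ f x y))   ≡⟨ cong (- g x *_) (deg-cancel x (λ y → φ p (∂ f x y))) ⟨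
          - g x * (deg x * Δ p f x)
              ≡⟨ solve 3 (λ g d q → :- g :* (d :* q) := :- (d :* (g :* q))) refl (g x) (deg x)
                  (Δ p f x) ⟩
          - (deg x * (g x * Δ p f x))               ∎)
        (sum-neg (λ x → deg x * (g x * Δ p f x)))

    ∫𝓛≡0 : ∀ f h → ∫ (𝓛 p f h) ≡ 0#
    ∫𝓛≡0 f h = *-cancelˡ-≡ 0<2 (begin
      2# * T           ≡⟨ solve 1 (λ t → (:1 :+ :1) :* t := t :+ t) refl T ⟩
      T + T            ≡⟨ cong (T +_) T≡-T ⟩
      T + - T          ≡⟨ -‿inverseʳ T ⟩
      0#               ≡⟨ zeroʳ 2# ⟨
      2# * 0#          ∎)
      where
      open ≡-Reasoning
      T : ℝ
      T = ∫ (𝓛 p f h)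
      a : V → V → ℝ
      a x y = ∣ ∂ f x y ∣ ^ᴿ (p - 2#) * (h y - h x)
      T≡ : T ≡ sum (λ x → sumNbrs x (a x))
      T≡ = sum-cong-≗ λ x → deg-cancel x (a x)
      flip : ∀ {x y} → x ~ y → a y x ≡ - 1# * a x y
      flip {x} {y} x~y = trans (cong (λ u → u ^ᴿ (p - 2#) * (h x - h y)) (∣∂∣-sym f x~y))
        (solve 3 (λ w u v → w :* (u :- v) := (:- :1) :* (w :* (v :- u))) refl
            (∣ ∂ f x y ∣ ^ᴿ (p - 2#)) (h x) (h y))
      T≡-T : T ≡ - T
      T≡-T = begin
        T                                            ≡⟨ T≡ ⟩
        sum (λ x → sumNbrs x (a x))                  ≡⟨ edge-sum-swap a ⟩
        sum (λ x → sumNbrs x (λ y → a y x))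
            ≡⟨ sum-cong-≗ (λ x → trans (nbrs-cong x flip) (nbrs-scale x (- 1#) (a x))) ⟩
        sum (λ x → - 1# * sumNbrs x (a x))           ≡⟨ *-distribˡ-sum (- 1#) (λ x → sumNbrs x (a x)) ⟨
        - 1# * sum (λ x → sumNbrs x (a x))           ≡⟨ cong (- 1# *_) T≡ ⟨
        - 1# * T                                     ≡⟨ solve 1 (λ t → (:- :1) :* t := :- t) refl T ⟩
        - T                                          ∎

    ∫Γ₂ : ∀ f → ∫ (Γ₂ p f) ≡ ∫ (λ x → Δ p f x * Δ p f x)
    ∫Γ₂ f = begin
      ∫ (λ x → 1# / 2# * 𝓛 p f (Γ p f f) x - Γ p f (Δ p f) x)
        ≡⟨ ∫-cong (λ x → cong (1# / 2# * 𝓛 p f (Γ p f f) x +_)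
            (solve 1 (λ a → :- a := (:- :1) :* a) refl (Γ p f (Δ p f) x))) ⟩
      ∫ (λ x → 1# / 2# * 𝓛 p f (Γ p f f) x + - 1# * Γ p f (Δ p f) x)
        ≡⟨ ∫-+ (λ x → 1# / 2# * 𝓛 p f (Γ p f f) x) (λ x → - 1# * Γ p f (Δ p f) x) ⟩
      ∫ (λ x → 1# / 2# * 𝓛 p f (Γ p f f) x) + ∫ (λ x → - 1# * Γ p f (Δ p f) x)
        ≡⟨ cong₂ _+_ (∫-scale (1# / 2#) (𝓛 p f (Γ p f f))) (∫-scale (- 1#) (Γ p f (Δ p f))) ⟩
      1# / 2# * ∫ (𝓛 p f (Γ p f f)) + - 1# * ∫ (Γ p f (Δ p f))
        ≡⟨ cong₂ (λ u v → 1# / 2# * u + - 1# * v) (∫𝓛≡0 f (Γ p f f)) (green f (Δ p f)) ⟩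
      1# / 2# * 0# + - 1# * - D
        ≡⟨ solve 2 (λ h d → h :* :0 :+ (:- :1) :* (:- d) := d) refl (1# / 2#) D ⟩
      D ∎
      where
      open ≡-Reasoning
      D : ℝ
      D = ∫ (λ x → Δ p f x * Δ p f x)

    φ*-nonNeg : ∀ t → 0# ≤ φ p t * t
    φ*-nonNeg t = subst (0# ≤_) (sym (*-assoc _ _ _))
        (*-nonNeg (^ᴿ-nonNeg (p - 2#) (∣∣-nonNeg t)) (sq-nonNeg t))

    Γ-nonNeg : ∀ f x → 0# ≤ Γ p f f x
    Γ-nonNeg f x = [ (λ x≁ → ≤-reflexive (sym (trans
        (cong (1# / (2# * deg x) *_) (nbrs-empty x _ x≁)) (zeroʳ _))))
      , (λ 1≤d → *-nonNeg (<⇒≤ (/-pos 0<1 (0<-* 0<2 (<-≤-trans 0<1 1≤d))))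
          (nbrs-nonNeg x λ y → φ*-nonNeg (∂ f x y))) ]′
      (isolated-or-1≤deg x)

  -- The curvature inequality for arbitrary functions.

  module _ {p : ℝ} (0≤p-2 : 0# ≤ p - 2#) where
    lim-weight : ∀ {T t} → T ⟶ t → (λ h → ∣ T h ∣ ^ᴿ (p - 2#)) ⟶ ∣ t ∣ ^ᴿ (p - 2#)
    lim-weight {T} {t} T⟶t = lim-^ᴿ 0≤p-2 (∣∣-nonNeg t) (λ h → ∣∣-nonNeg (T h)) (lim-∣∣ T⟶t)

    lim-φ : ∀ {T t} → T ⟶ t → (λ h → φ p (T h)) ⟶ φ p t
    lim-φ T⟶t = lim-* (lim-weight T⟶t) T⟶t

    module _ {F : ℝ → V → ℝ} {f : V → ℝ} (F⟶f : ∀ x → (λ h → F h x) ⟶ f x) where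
      lim-∂ : ∀ x y → (λ h → ∂ (F h) x y) ⟶ ∂ f x y
      lim-∂ x y = lim-- (lim-* (lim-const (sign x y)) (F⟶f y)) (F⟶f x)

      lim-Δ : ∀ x → (λ h → Δ p (F h) x) ⟶ Δ p f x
      lim-Δ x = lim-* (lim-const _) (lim-nbrs x λ y → lim-φ (lim-∂ x y))

      lim-𝓛 : ∀ {H : ℝ → V → ℝ} {k} → (∀ x → (λ h → H h x) ⟶ k x) → ∀ x →
          (λ h → 𝓛 p (F h) (H h) x) ⟶ 𝓛 p f k x
      lim-𝓛 H⟶k x = lim-* (lim-const _) (lim-nbrs x λ y → lim-* (lim-weight (lim-∂ x y))
          (lim-- (H⟶k y) (H⟶k x)))

    lim-Γ : ∀ {F : ℝ → V → ℝ} {f} {H : ℝ → V → ℝ} {k} → (∀ x → (λ h → F h x) ⟶ f x) →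
        (∀ x → (λ h → H h x) ⟶ k x) →
      ∀ x → (λ h → Γ p (F h) (H h) x) ⟶ Γ p f k x
    lim-Γ F⟶f H⟶k x = lim-* (lim-const _) (lim-nbrs x λ y → lim-* (lim-φ (lim-∂ F⟶f x y)) (lim-∂ H⟶k x y))

    lim-Γ₂ : ∀ {F : ℝ → V → ℝ} {f} → (∀ x → (λ h → F h x) ⟶ f x) → ∀ x → (λ h → Γ₂ p (F h) x) ⟶ Γ₂ p f x
    lim-Γ₂ F⟶f x = lim-- (lim-* (lim-const _) (lim-𝓛 F⟶f (lim-Γ F⟶f F⟶f) x)) (lim-Γ F⟶f (lim-Δ F⟶f) x)

  -- Adding h > 0 to the value at x makes all differences at x nonzero as
  -- soon as h avoids finitely many values; p ≥ 2 makes everything continuous.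
  CD-everywhere : ∀ {p K N} → 0# ≤ p - 2# → 0# ≤ (2# * p - 2#) / p → CD p K N →
    ∀ f x → (1/ᴰ N) * (Δ p f x * Δ p f x) + K * Γ p f f x ^ᴿ ((2# * p - 2#) / p) ≤ Γ₂ p f x
  CD-everywhere {p} {K} {N} 0≤p-2 0≤r cd f x = lim-≤
    (lim-+ (lim-* (lim-const (1/ᴰ N)) (lim-* (lim-Δ 0≤p-2 F⟶f x) (lim-Δ 0≤p-2 F⟶f x)))
      (lim-* (lim-const K) (lim-^ᴿ 0≤r (Γ-nonNeg p f x) (λ h → Γ-nonNeg p (F h) x) (lim-Γ 0≤p-2 F⟶f F⟶f x))))
    (lim-Γ₂ 0≤p-2 F⟶f x)
    (ev-map (λ {h} avoids → subst (λ z → (1/ᴰ N) * z + K * Γ p (F h) (F h) x ^ᴿ ((2# * p - 2#) / p)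
        ≤ Γ₂ p (F h) x)
        (cong (Δ p (F h) x *_) (*-identityʳ (Δ p (F h) x))) (cd x (F h) (nonzero avoids)))
      (ev-∀ {Q = λ y h → h ≢ ∂ f x y} λ y → ev-≢ (∂ f x y)))
    where
    δ : V → ℝ
    δ v = if does (v Finₚ.≟ x) then 1# else 0#
    δ-same : δ x ≡ 1#
    δ-same = cong (λ b → if b then 1# else 0#) (dec-true (x Finₚ.≟ x) refl)
    δ-other : ∀ {y} → x ~ y → δ y ≡ 0#
    δ-other {y} x~y = cong (λ b → if b then 1# else 0#)
        (dec-false (y Finₚ.≟ x) λ y≡x → ~-irrefl (sym y≡x) x~y)
    -- The bump depends on `x`, which is harmless: the condition is pointwise and restricts only the
    -- differences at `x`.
    F : ℝ → V → ℝ
    F h v = f v + h * δ v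
    F⟶f : ∀ v → (λ h → F h v) ⟶ f v
    F⟶f v = subst ((λ h → F h v) ⟶_) (trans (cong (f v +_) (zeroˡ (δ v))) (+-identityʳ (f v)))
      (lim-+ (lim-const (f v)) (lim-* lim-h (lim-const (δ v))))
    ∂F : ∀ h {y} → x ~ y → ∂ (F h) x y ≡ ∂ f x y - h
    ∂F h {y} x~y = trans (cong₂ (λ u v → sign x y * (f y + h * u) - (f x + h * v)) (δ-other x~y) δ-same)
      (solve 4 (λ s a b h → s :* (a :+ h :* :0) :- (b :+ h :* :1) := s :* a :- b :- h) refl
          (sign x y) (f y) (f x) h)
    nonzero : ∀ {h} → (∀ y → h ≢ ∂ f x y) → ∀ y → x ~ y → ∂ (F h) x y ≢ 0#
    nonzero {h} avoids y x~y ∂F≡0 = avoids y (trans (sym (+-identityˡ h))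
        (trans (cong (_+ h) (trans (sym ∂F≡0) (∂F h x~y)))
      (solve 2 (λ d h → d :- h :+ h := d) refl (∂ f x y) h)))

-- The estimate for an eigenfunction.

module EigenvalueBound (R : CompleteOrderedField) {n : ℕ} (G : SignedGraph n) where
  open OrderedField R
  open PowerLaws R
  open RealBernoulli R
  open Limits R
  open SignedGraph G
  open SignedLaplacian R G
  open GraphCalculus R G

  module Exponents {p : ℝ} (2≤p : 2# ≤ p) where
    -- `ρ` equals `(p - 2) / p` and `τ` equals `2 / p`. Multiplied by `p / 2` they become the
    -- exponent of the volume and 1.
    r ρ τ : ℝ
    r = (2# * p - 2#) / p
    ρ = r - 1#
    τ = 2# - r

    0<p : 0# < p
    0<p = <-≤-trans 0<2 2≤p

    0≤p-2 : 0# ≤ p - 2#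
    0≤p-2 = ≤⇒0≤- 2≤p

    rp≡ : r * p ≡ 2# * p - 2#
    rp≡ = /-cancel 0<p

    1≤r : 1# ≤ r
    1≤r = ≤-/ 0<p (≤-by 0≤p-2 (solve 1 (λ p → (:1 :+ :1) :* p :- (:1 :+ :1) := :1 :* p :+
        (p :- (:1 :+ :1))) refl p))

    0≤r : 0# ≤ r
    0≤r = ≤-trans 0≤1 1≤r

    0≤ρ : 0# ≤ ρ
    0≤ρ = ≤⇒0≤- 1≤r

    pρ≡ : p * ρ ≡ p - 2#
    pρ≡ = trans (solve 2 (λ p r → p :* (r :- :1) := r :* p :- p) refl p r)
      (trans (cong (_- p) rp≡) (solve 1 (λ p → (:1 :+ :1) :* p :- (:1 :+ :1) :- p := p :- (:1 :+ :1)) refl p))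

    ρ*p/2 : ρ * (p / 2#) ≡ (p - 2#) / 2#
    ρ*p/2 = trans (sym (*-assoc _ _ _)) (cong (_/ 2#) (trans (*-comm ρ p) pρ≡))

    τ*p/2 : τ * (p / 2#) ≡ 1#
    τ*p/2 = trans (sym (*-assoc _ _ _)) (trans
        (cong (_/ 2#) (trans (solve 2 (λ p r → ((:1 :+ :1) :- r) :* p := (:1 :+ :1) :* p :- r :* p)
            refl p r)
      (trans (cong (λ z → 2# * p - z) rp≡) (solve 1
          (λ p → (:1 :+ :1) :* p :- ((:1 :+ :1) :* p :- (:1 :+ :1)) := (:1 :+ :1)) refl p))))
              (inverse 0<2))

    0≤p/2 : 0# ≤ p / 2#
    0≤p/2 = /-nonNeg (<⇒≤ 0<p) 0<2

    *^ρ : ∀ {a} → 0# < a → a * a ^ᴿ ρ ≡ a ^ᴿ r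
    *^ρ {a} 0<a = begin
      a * a ^ᴿ ρ          ≡⟨ cong (_* a ^ᴿ ρ) (^ᴿ-1 0<a) ⟨
      a ^ᴿ 1# * a ^ᴿ ρ    ≡⟨ ^ᴿ-homo 1# ρ 0<a ⟨
      a ^ᴿ (1# + ρ)       ≡⟨ cong (a ^ᴿ_) (solve 1 (λ r → :1 :+ (r :- :1) := r) refl r) ⟩
      a ^ᴿ r              ∎
      where open ≡-Reasoning

    square-split : ∀ {a} → 0# < a → a * a ≡ a ^ᴿ r * a ^ᴿ τ
    square-split {a} 0<a = begin
      a * a               ≡⟨ cong₂ _*_ (^ᴿ-1 0<a) (^ᴿ-1 0<a) ⟨
      a ^ᴿ 1# * a ^ᴿ 1#   ≡⟨ ^ᴿ-homo 1# 1# 0<a ⟨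
      a ^ᴿ 2#             ≡⟨ cong (a ^ᴿ_) (solve 1 (λ r → :1 :+ :1 := r :+ (:1 :+ :1 :- r)) refl r) ⟩
      a ^ᴿ (r + τ)        ≡⟨ ^ᴿ-homo r τ 0<a ⟩
      a ^ᴿ r * a ^ᴿ τ     ∎
      where open ≡-Reasoning

    -- To be used with `v` the volume and `u` its inverse. Both sides contain `μ ^ᴿ r * A ^ᴿ r`;
    -- cancelling it leaves `u ^ᴿ ρ * κ ≤ μ ^ᴿ τ`, and the power `p / 2` isolates `μ`.
    solve-for-μ : ∀ {κ u v μ A} → 0# < κ → 0# < u → 0# < μ → 0# < A → v * u ≡ 1# →
      κ * (v * (μ * A * u) ^ᴿ r) ≤ μ * μ * (A * A ^ᴿ ρ) →
      u ^ᴿ ((p - 2#) / 2#) * κ ^ᴿ (p / 2#) ≤ μ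
    solve-for-μ {κ} {u} {v} {μ} {A} 0<κ 0<u 0<μ 0<A vu≡1 le = begin
      u ^ᴿ ((p - 2#) / 2#) * κ ^ᴿ (p / 2#)     ≡⟨ cong (λ z → u ^ᴿ z * κ ^ᴿ (p / 2#)) ρ*p/2 ⟨
      u ^ᴿ (ρ * (p / 2#)) * κ ^ᴿ (p / 2#)      ≡⟨ cong (_* κ ^ᴿ (p / 2#)) (^ᴿ-assoc ρ (p / 2#) 0<u) ⟨
      (u ^ᴿ ρ) ^ᴿ (p / 2#) * κ ^ᴿ (p / 2#)     ≡⟨ ^ᴿ-distrib-* (p / 2#) 0<uᵖ 0<κ ⟨
      (u ^ᴿ ρ * κ) ^ᴿ (p / 2#)                 ≤⟨ ^ᴿ-mono-≤ 0≤p/2 (<⇒≤ (0<-* 0<uᵖ 0<κ)) root ⟩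
      (μ ^ᴿ τ) ^ᴿ (p / 2#)                     ≡⟨ ^ᴿ-assoc τ (p / 2#) 0<μ ⟩
      μ ^ᴿ (τ * (p / 2#))                      ≡⟨ cong (μ ^ᴿ_) τ*p/2 ⟩
      μ ^ᴿ 1#                                  ≡⟨ ^ᴿ-1 0<μ ⟩
      μ                                        ∎
      where
      open ≤-Reasoning
      0<uᵖ : 0# < u ^ᴿ ρ
      0<uᵖ = ^ᴿ-pos ρ 0<u
      M B : ℝ
      M = μ ^ᴿ r
      B = A ^ᴿ r
      lhs : κ * (v * (μ * A * u) ^ᴿ r) ≡ M * B * (u ^ᴿ ρ * κ)
      lhs = begin-equality
        κ * (v * (μ * A * u) ^ᴿ r)
            ≡⟨ cong (λ z → κ * (v * z)) (trans (^ᴿ-distrib-* r (0<-* 0<μ 0<A) 0<u)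
                (cong₂ _*_ (^ᴿ-distrib-* r 0<μ 0<A) (sym (*^ρ 0<u)))) ⟩
        κ * (v * (M * B * (u * u ^ᴿ ρ)))
            ≡⟨ cong (κ *_) (solve 4 (λ v m u w → v :* (m :* (u :* w)) := (v :* u) :* (m :* w)) refl
                v (M * B) u (u ^ᴿ ρ)) ⟩
        κ * (v * u * (M * B * u ^ᴿ ρ))         ≡⟨ cong (λ z → κ * (z * (M * B * u ^ᴿ ρ))) vu≡1 ⟩
        κ * (1# * (M * B * u ^ᴿ ρ))
            ≡⟨ solve 3 (λ k m w → k :* (:1 :* (m :* w)) := m :* (w :* k)) refl κ (M * B) (u ^ᴿ ρ) ⟩
        M * B * (u ^ᴿ ρ * κ)                   ∎
      rhs : μ * μ * (A * A ^ᴿ ρ) ≡ M * B * μ ^ᴿ τ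
      rhs = trans (cong₂ _*_ (square-split 0<μ) (*^ρ 0<A))
          (solve 3 (λ m t b → m :* t :* b := m :* b :* t) refl M (μ ^ᴿ τ) B)
      root : u ^ᴿ ρ * κ ≤ μ ^ᴿ τ
      root = *-cancelˡ-≤ (0<-* (^ᴿ-pos r 0<μ) (^ᴿ-pos r 0<A)) (subst₂ _≤_ lhs rhs le)

    -- The graph of the power lies above its tangent at the mean `m`; dividing by `m` moves the
    -- point of contact to 1, where `^ᴿ-bernoulli` applies.
    jensen : ∀ {g} → (∀ x → 0# ≤ g x) → 0# < ∫ g → 0# < vol → vol * (∫ g * (1# / vol)) ^ᴿ r ≤ ∫
        (λ x → g x ^ᴿ r)
    jensen {g} 0≤g 0<∫g 0<vol = begin
      vol * m ^ᴿ r                                       ≡⟨ *-comm _ _ ⟩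
      m ^ᴿ r * vol                                       ≡⟨ cong (m ^ᴿ r *_) tangent ⟨
      m ^ᴿ r * ∫ (λ x → (1# - r) * 1# + r / m * g x)
          ≡⟨ ∫-scale (m ^ᴿ r) (λ x → (1# - r) * 1# + r / m * g x) ⟨
      ∫ (λ x → m ^ᴿ r * ((1# - r) * 1# + r / m * g x))    ≤⟨ ∫-mono (λ x → pointwise x (0≤⇒≡0⊎0< (0≤g x))) ⟩
      ∫ (λ x → g x ^ᴿ r)                                  ∎
      where
      open ≤-Reasoning
      m : ℝ
      m = ∫ g * (1# / vol)
      0<m : 0# < m
      0<m = 0<-* 0<∫g (/-pos 0<1 0<vol)
      ∫g≡ : ∫ g ≡ m * vol
      ∫g≡ = sym (trans (*-assoc _ _ _) (trans (cong (∫ g *_) (/-cancel 0<vol)) (*-identityʳ _)))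
      -- The constant is kept as `(1# - r) * 1#` so that `∫-scale` and `∫-1` evaluate its integral.
      tangent : ∫ (λ x → (1# - r) * 1# + r / m * g x) ≡ vol
      tangent = begin-equality
        ∫ (λ x → (1# - r) * 1# + r / m * g x)             ≡⟨ ∫-+ (λ _ → (1# - r) * 1#) (λ x → r / m * g x) ⟩
        ∫ (λ _ → (1# - r) * 1#) + ∫ (λ x → r / m * g x)
            ≡⟨ cong₂ _+_ (∫-scale (1# - r) (λ _ → 1#)) (∫-scale (r / m) g) ⟩
        (1# - r) * ∫ (λ _ → 1#) + r / m * ∫ g
            ≡⟨ cong₂ (λ a b → (1# - r) * a + r / m * b) ∫-1 ∫g≡ ⟩
        (1# - r) * vol + r / m * (m * vol)
            ≡⟨ cong ((1# - r) * vol +_) (trans (sym (*-assoc _ _ _)) (cong (_* vol) (/-cancel 0<m)))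
                ⟩
        (1# - r) * vol + r * vol
            ≡⟨ solve 2 (λ r v → (:1 :- r) :* v :+ r :* v := v) refl r vol ⟩
        vol                                                ∎
      bernoulli-at : ∀ x → (1# - r) * 1# + r / m * g x ≤ (g x / m) ^ᴿ r
      bernoulli-at x = subst (_≤ (g x / m) ^ᴿ r)
        (solve 3 (λ r g i → :1 :+ r :* (g :* i :- :1) := (:1 :- r) :* :1 :+ r :* i :* g) refl r (g x) (m ⁻¹))
        (^ᴿ-bernoulli (/-nonNeg (0≤g x) 0<m) 1≤r)
      rescaled : ∀ x → g x ≡ 0# ⊎ 0# < g x → m ^ᴿ r * (g x / m) ^ᴿ r ≡ g x ^ᴿ r
      -- `^ᴿ-distrib-*` wants positive bases; at 0 both sides vanish because `r ≥ 1`.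
      rescaled x (inj₁ g≡0) = trans (cong (λ z → m ^ᴿ r * z)
          (trans (cong (_^ᴿ r) (trans (cong (_/ m) g≡0) (zeroˡ _))) 0ʳ))
        (trans (zeroʳ _) (sym (trans (cong (_^ᴿ r) g≡0) 0ʳ)))
        where
        0ʳ : 0# ^ᴿ r ≡ 0#
        0ʳ = 0^ᴿ (<⇒≢ (<-≤-trans 0<1 1≤r))
      rescaled x (inj₂ 0<g) = trans (sym (^ᴿ-distrib-* r 0<m (/-pos 0<g 0<m)))
        (cong (_^ᴿ r) (trans (*-comm m _) (/-cancel 0<m)))
      pointwise : ∀ x → g x ≡ 0# ⊎ 0# < g x → m ^ᴿ r * ((1# - r) * 1# + r / m * g x) ≤ g x ^ᴿ r
      pointwise x c = subst (m ^ᴿ r * ((1# - r) * 1# + r / m * g x) ≤_) (rescaled x c)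
          (*-monoʳ-≤ (<⇒≤ (^ᴿ-pos r 0<m)) (bernoulli-at x))

    module Eigenfunction {μ : ℝ} (μ≢0 : μ ≢ 0#) (f : V → ℝ) (f≢0 : ∃[ x ] f x ≢ 0#)
                         (eigen : ∀ x → - Δ p f x ≡ μ * φ p (f x)) where
      a : V → ℝ
      a x = φ p (f x) * f x

      A : ℝ
      A = ∫ a

      a-nonNeg : ∀ x → 0# ≤ a x
      a-nonNeg x = φ*-nonNeg p (f x)

      weight-pos : ∀ {x} → f x ≢ 0# → 0# < ∣ f x ∣ ^ᴿ (p - 2#)
      weight-pos f≢0 = ^ᴿ-pos (p - 2#) (∣∣-pos f≢0)

      φ≢0 : ∀ {x} → f x ≢ 0# → φ p (f x) ≢ 0#
      φ≢0 f≢0 φ≡0 = f≢0 (*-zero-cancel (<⇒≢ (weight-pos f≢0)) φ≡0)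

      -- At an isolated vertex `Δ p f` vanishes whatever the inverse of 0 is, so the eigenvalue
      -- equation with `μ ≢ 0#` forces `f x` to be 0.
      1≤deg : ∀ {x} → f x ≢ 0# → 1# ≤ deg x
      1≤deg {x} fx≢0 = [ (λ x≁ → contradiction (isolated x≁) (φ≢0 fx≢0)) , (λ le → le) ]′
          (isolated-or-1≤deg x)
        where
        isolated : (∀ y → ¬ x ~ y) → φ p (f x) ≡ 0#
        isolated x≁ = *-zero-cancel μ≢0 (trans (sym (eigen x)) (trans (cong -_
          (trans (cong (1# / deg x *_) (nbrs-empty x (λ y → φ p (∂ f x y)) x≁)) (zeroʳ _))) -0#≈0#))

      a≡∣f∣^p : ∀ {x} → f x ≢ 0# → a x ≡ ∣ f x ∣ ^ᴿ p
      a≡∣f∣^p {x} fx≢0 = begin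
        w * f x * f x                          ≡⟨ *-assoc _ _ _ ⟩
        w * (f x * f x)                        ≡⟨ cong (w *_) (∣x∣∣x∣≡xx (f x)) ⟨
        w * (∣ f x ∣ * ∣ f x ∣)                ≡⟨ cong (w *_) (cong₂ _*_ (^ᴿ-1 0<∣f∣) (^ᴿ-1 0<∣f∣)) ⟨
        w * (∣ f x ∣ ^ᴿ 1# * ∣ f x ∣ ^ᴿ 1#)    ≡⟨ cong (w *_) (^ᴿ-homo 1# 1# 0<∣f∣) ⟨
        w * ∣ f x ∣ ^ᴿ 2#                      ≡⟨ ^ᴿ-homo (p - 2#) 2# 0<∣f∣ ⟨
        ∣ f x ∣ ^ᴿ (p - 2# + 2#)
            ≡⟨ cong (∣ f x ∣ ^ᴿ_) (solve 2 (λ p t → p :- t :+ t := p) refl p 2#) ⟩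
        ∣ f x ∣ ^ᴿ p                           ∎
        where
        open ≡-Reasoning
        w : ℝ
        w = ∣ f x ∣ ^ᴿ (p - 2#)
        0<∣f∣ : 0# < ∣ f x ∣
        0<∣f∣ = ∣∣-pos fx≢0

      a≤A : ∀ {x} → f x ≢ 0# → a x ≤ A
      a≤A {x} fx≢0 = ≤-trans (subst (_≤ deg x * a x) (*-identityˡ (a x))
          (*-monoˡ-≤ (a-nonNeg x) (1≤deg fx≢0)))
        (term≤sum {g = λ y → deg y * a y} (λ y → *-nonNeg (deg-nonNeg y) (a-nonNeg y)) x)

      0<A : 0# < A
      0<A = <-≤-trans (subst (0# <_) (sym (a≡∣f∣^p (proj₂ f≢0))) (^ᴿ-pos p (∣∣-pos (proj₂ f≢0))))
          (a≤A (proj₂ f≢0))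

      0<vol : 0# < vol
      0<vol = <-≤-trans (<-≤-trans 0<1 (1≤deg (proj₂ f≢0))) (term≤sum deg-nonNeg (proj₁ f≢0))

      ∫Γ≡μA : ∫ (Γ p f f) ≡ μ * A
      ∫Γ≡μA = begin
        ∫ (Γ p f f)                       ≡⟨ green p f f ⟩
        - ∫ (λ x → f x * Δ p f x)          ≡⟨ solve 1 (λ a → :- a := (:- :1) :* a) refl
            (∫ (λ x → f x * Δ p f x)) ⟩
        - 1# * ∫ (λ x → f x * Δ p f x)     ≡⟨ ∫-scale (- 1#) (λ x → f x * Δ p f x) ⟨
        ∫ (λ x → - 1# * (f x * Δ p f x))   ≡⟨ ∫-cong
            (λ x → trans (solve 2 (λ f d → (:- :1) :* (f :* d) := :- d :* f) refl (f x) (Δ p f x))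
                                              (trans (cong (_* f x) (eigen x)) (*-assoc _ _ _))) ⟩
        ∫ (λ x → μ * a x)                 ≡⟨ ∫-scale μ a ⟩
        μ * A                             ∎
        where open ≡-Reasoning

      -- `μ * A` is the integral of the nonnegative `Γ p f f`, and `A` is positive: the sign of a
      -- Rayleigh quotient.
      0<μ : 0# < μ
      0<μ = *-cancelʳ-≤ 0<A (subst₂ _≤_ (sym (zeroˡ A)) ∫Γ≡μA
          (sum-nonNeg λ x → *-nonNeg (deg-nonNeg x) (Γ-nonNeg p f x)))
        , μ≢0 ∘ sym

      -- The square is `a x` times the weight, and the weight is `a x ^ᴿ ρ` because `p * ρ` is
      -- `p - 2#`. Zeros of `f` are treated apart, as the power laws want a positive base.
      φ²≤ : ∀ x → φ p (f x) * φ p (f x) ≤ a x * A ^ᴿ ρ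
      φ²≤ x = [ zero-value , nonzero-value ]′ (toSum (f x ≟ 0#))
        where
        open ≤-Reasoning
        w : ℝ
        w = ∣ f x ∣ ^ᴿ (p - 2#)
        zero-value : f x ≡ 0# → φ p (f x) * φ p (f x) ≤ a x * A ^ᴿ ρ
        zero-value fx≡0 = begin
          φ p (f x) * φ p (f x)  ≡⟨ cong (φ p (f x) *_) (trans (cong (w *_) fx≡0) (zeroʳ w)) ⟩
          φ p (f x) * 0#         ≡⟨ zeroʳ _ ⟩
          0#                     ≤⟨ *-nonNeg (a-nonNeg x) (<⇒≤ (^ᴿ-pos ρ 0<A)) ⟩
          a x * A ^ᴿ ρ           ∎
        nonzero-value : f x ≢ 0# → φ p (f x) * φ p (f x) ≤ a x * A ^ᴿ ρ
        nonzero-value fx≢0 = begin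
          w * f x * (w * f x)               ≡⟨ solve 2
              (λ w f → w :* f :* (w :* f) := w :* f :* f :* w) refl w (f x) ⟩
          a x * ∣ f x ∣ ^ᴿ (p - 2#)         ≡⟨ cong (λ z → a x * ∣ f x ∣ ^ᴿ z) pρ≡ ⟨
          a x * ∣ f x ∣ ^ᴿ (p * ρ)          ≡⟨ cong (a x *_) (^ᴿ-assoc p ρ (∣∣-pos fx≢0)) ⟨
          a x * (∣ f x ∣ ^ᴿ p) ^ᴿ ρ         ≡⟨ cong (λ z → a x * z ^ᴿ ρ) (a≡∣f∣^p fx≢0) ⟨
          a x * a x ^ᴿ ρ                    ≤⟨ *-monoʳ-≤ (a-nonNeg x)
              (^ᴿ-mono-≤ 0≤ρ (a-nonNeg x) (a≤A fx≢0)) ⟩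
          a x * A ^ᴿ ρ                      ∎

      ∫Δ²≤ : ∫ (λ x → Δ p f x * Δ p f x) ≤ μ * μ * (A * A ^ᴿ ρ)
      ∫Δ²≤ = begin
        ∫ (λ x → Δ p f x * Δ p f x)
            ≡⟨ ∫-cong (λ x → trans (solve 1 (λ d → d :* d := (:- d) :* (:- d)) refl (Δ p f x))
                                                               (trans (cong₂ _*_ (eigen x)
                                                                   (eigen x)) (*-interchange _ _ _
                                                                       _))) ⟩
        ∫ (λ x → μ * μ * (φ p (f x) * φ p (f x)))
            ≡⟨ ∫-scale (μ * μ) (λ x → φ p (f x) * φ p (f x)) ⟩
        μ * μ * ∫ (λ x → φ p (f x) * φ p (f x))              ≤⟨ *-monoʳ-≤ (sq-nonNeg μ) (∫-mono φ²≤) ⟩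
        μ * μ * ∫ (λ x → a x * A ^ᴿ ρ)
            ≡⟨ cong (μ * μ *_) (trans (∫-cong (λ x → *-comm _ _))
                (trans (∫-scale (A ^ᴿ ρ) a) (*-comm _ _))) ⟩
        μ * μ * (A * A ^ᴿ ρ)                                 ∎
        where open ≤-Reasoning

      module _ {K : ℝ} {N : Dimension} (cd : CD p K N) where
        integrated-CD : (1/ᴰ N) * ∫ (λ x → Δ p f x * Δ p f x) + K * ∫ (λ x → Γ p f f x ^ᴿ r) ≤ ∫
            (λ x → Δ p f x * Δ p f x)
        integrated-CD = subst₂ _≤_
          (trans (∫-+ (λ x → (1/ᴰ N) * (Δ p f x * Δ p f x)) (λ x → K * Γ p f f x ^ᴿ r))
            (cong₂ _+_ (∫-scale (1/ᴰ N) (λ x → Δ p f x * Δ p f x)) (∫-scale K (λ x → Γ p f f x ^ᴿ r))))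
          (∫Γ₂ p f) (∫-mono (CD-everywhere {N = N} 0≤p-2 0≤r cd f))

        -- Characterising `κ` by an equation treats finite and infinite dimension alike; the
        -- positive factor `1# - (1/ᴰ N)` cancels from the integrated inequality.
        lower-bound : ∀ {κ} → 0# < κ → 0# < 1# - (1/ᴰ N) → κ * (1# - (1/ᴰ N)) ≡ K →
          (1# / vol) ^ᴿ ((p - 2#) / 2#) * κ ^ᴿ (p / 2#) ≤ μ
        lower-bound {κ} 0<κ 0<c κc≡K = solve-for-μ 0<κ (/-pos 0<1 0<vol) 0<μ 0<A
          (trans (*-comm vol (1# / vol)) (/-cancel 0<vol)) (begin
          κ * (vol * (μ * A * (1# / vol)) ^ᴿ r)     ≡⟨ cong (λ z → κ * (vol * (z * (1# / vol)) ^ᴿ r)) ∫Γ≡μA ⟨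
          κ * (vol * (∫ (Γ p f f) * (1# / vol)) ^ᴿ r)
              ≤⟨ *-monoʳ-≤ (<⇒≤ 0<κ) (jensen (Γ-nonNeg p f)
                  (subst (0# <_) (sym ∫Γ≡μA) (0<-* 0<μ 0<A)) 0<vol) ⟩
          κ * ∫Γʳ                                   ≤⟨ *-cancelˡ-≤ 0<c (≤-by (≤⇒0≤- integrated-CD) collect) ⟩
          ∫ΔΔ                                       ≤⟨ ∫Δ²≤ ⟩
          μ * μ * (A * A ^ᴿ ρ)                      ∎)
          where
          open ≤-Reasoning
          ∫Γʳ ∫ΔΔ : ℝ
          ∫Γʳ = ∫ (λ x → Γ p f f x ^ᴿ r)
          ∫ΔΔ = ∫ (λ x → Δ p f x * Δ p f x)
          collect : (1# - (1/ᴰ N)) * ∫ΔΔ ≡ (1# - (1/ᴰ N)) * (κ * ∫Γʳ) + (∫ΔΔ - ((1/ᴰ N) * ∫ΔΔ + K * ∫Γʳ))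
          collect = trans (solve 4 (λ i d k g → (:1 :- i) :* d := (:1 :- i) :* (k :* g) :+
              (d :- (i :* d :+ k :* (:1 :- i) :* g))) refl (1/ᴰ N) ∫ΔΔ κ ∫Γʳ)
            (cong (λ z → (1# - (1/ᴰ N)) * (κ * ∫Γʳ) + (∫ΔΔ - ((1/ᴰ N) * ∫ΔΔ + z * ∫Γʳ))) κc≡K)

  dimFactor-spec : ∀ {K} N → 1<ᴰ N → 0# < K →
    0# < dimFactor N K × 0# < 1# - (1/ᴰ N) × dimFactor N K * (1# - (1/ᴰ N)) ≡ K
  dimFactor-spec {K} ∞ _ 0<K = 0<K , subst (0# <_) 1≡1-0 0<1 , trans (cong (K *_) (sym 1≡1-0)) (*-identityʳ K)
    where
    1≡1-0 : 1# ≡ 1# - 0#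
    1≡1-0 = solve 0 (:1 := :1 :- :0) refl
  dimFactor-spec {K} (fin N) 1<N 0<K = /-pos (0<-* 0<N 0<K) 0<N-1
    , subst (0# <_) N-1/N (/-pos 0<N-1 0<N)
    , (begin
        N * K / (N - 1#) * (1# - 1# / N)             ≡⟨ cong (N * K / (N - 1#) *_) N-1/N ⟨
        N * K / (N - 1#) * ((N - 1#) / N)            ≡⟨ *-assoc (N * K / (N - 1#)) (N - 1#) (N ⁻¹) ⟨
        N * K / (N - 1#) * (N - 1#) * N ⁻¹           ≡⟨ cong (_* N ⁻¹) (/-cancel 0<N-1) ⟩
        N * K * N ⁻¹                                 ≡⟨ cong (_* N ⁻¹) (*-comm N K) ⟩
        K * N * N ⁻¹                                 ≡⟨ *-assoc K N (N ⁻¹) ⟩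
        K * (N * N ⁻¹)                               ≡⟨ cong (K *_) (inverse 0<N) ⟩
        K * 1#                                       ≡⟨ *-identityʳ K ⟩
        K                                            ∎)
    where
    open ≡-Reasoning
    0<N : 0# < N
    0<N = <-trans 0<1 1<N
    0<N-1 : 0# < N - 1#
    0<N-1 = ≤⇒0≤- (<⇒≤ 1<N) , λ 0≡ → proj₂ 1<N (trans (sym (+-identityˡ 1#)) (trans (cong (_+ 1#) 0≡)
      (solve 1 (λ n → n :- :1 :+ :1 := n) refl N)))
    N-1/N : (N - 1#) / N ≡ 1# - 1# / N
    N-1/N = by-unit (inverse 0<N) (λ z → z - 1# / N)
        (solve 2 (λ n i → (n :- :1) :* i := n :* i :- :1 :* i) refl N (N ⁻¹)) refl

theorem4p10 : (R : CompleteOrderedField) → let open CompleteOrderedField R in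
    (n : ℕ) (G : SignedGraph n) → SignedGraph.Connected G →
    let open SignedLaplacian R G in
    (p K : ℝ) (N : Dimension) →
    2# ≤ p → 1<ᴰ N → 0# < K →
    CD p K N →
    (μ : ℝ) → IsFirstNonzeroEigenvalue p μ →
    (1# / vol) ^ᴿ ((p - 2#) / 2#) * dimFactor N K ^ᴿ (p / 2#) ≤ μ
theorem4p10 R n G _ p K N 2≤p 1<N 0<K cd μ ((f , f≢0 , eigen) , μ≢0 , _) =
  lower-bound {N = N} cd 0<κ 0<c κc≡K
  where
  open EigenvalueBound R G
  open Exponents 2≤p
  open Eigenfunction μ≢0 f f≢0 eigen
  spec = dimFactor-spec N 1<N 0<K
  0<κ  = proj₁ spec
  0<c  = proj₁ (proj₂ spec)
  κc≡K = proj₂ (proj₂ spec)
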